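{- Let $r\geq 3$ be an integer. Then for all sufficiently large $n$, \[ ex(n,K_r,B_{r,0})=\mathcal{N}(K_{r-1},T_{r-1}(n-1)), \] and, up to isomorphism, $K_1\vee T_{r-1}(n-1)$ is the unique $B_{r,0}$-free graph on $n$ vertices attaining this maximum number of copies of $K_r$.
   Context: $B_{r,0}$ denotes the graph consisting of two vertex-disjoint copies of $K_r$. A graph is $F$-free if it contains no subgraph isomorphic to $F$. For graphs $T,F$, $ex(n,T,F)$ denotes the maximum number of copies of $T$ in an $F$-free graph on $n$ vertices, and $\mathcal{N}(T,G)$ denotes the number of copies of $T$ in the graph $G$. $T_r(m)$ denotes the $r$-partite Turán graph on $m$ vertices, i.e. the complete $r$-partite graph on $m$ vertices whose part sizes differ by at most one. The join $G_1\vee G_2$ is the disjoint union of $G_1$ and $G_2$ together with all edges between $V(G_1)$ and $V(G_2)$. -}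

module Defs where

open import Data.Nat using (ℕ; zero; suc; _%_; _≡ᵇ_)
open import Data.Bool using (Bool; true; false; not; _∧_; _∨_; if_then_else_)
open import Data.Fin using (Fin; zero; suc; toℕ)
open import Data.Vec using (Vec; []; _∷_; lookup)
open import Data.List using (List; []; _∷_; map; _++_; length; filterᵇ; allFin)
open import Data.Product using (Σ; _×_; _,_)
open import Relation.Binary.PropositionalEquality using (_≡_; refl; cong₂)
open import Relation.Nullary using (¬_)
open import Function.Definitions using (Injective)

record Graph (n : ℕ) : Set where
  field
    adj     : Fin n → Fin n → Bool
    sym     : ∀ i j → adj i j ≡ adj j i
    irrefl  : ∀ i → adj i i ≡ false
open Graph public

eqℕ : ℕ → ℕ → Bool
eqℕ zero zero = true
eqℕ zero (suc _) = false
eqℕ (suc _) zero = false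
eqℕ (suc m) (suc n) = eqℕ m n

eqℕ-sym : ∀ m n → eqℕ m n ≡ eqℕ n m
eqℕ-sym zero zero = refl
eqℕ-sym zero (suc _) = refl
eqℕ-sym (suc _) zero = refl
eqℕ-sym (suc m) (suc n) = eqℕ-sym m n

eqℕ-refl : ∀ m → eqℕ m m ≡ true
eqℕ-refl zero = refl
eqℕ-refl (suc m) = eqℕ-refl m

eqB : Bool → Bool → Bool
eqB a b = if a then b else not b

eqB-sym : ∀ a b → eqB a b ≡ eqB b a
eqB-sym true true = refl
eqB-sym true false = refl
eqB-sym false true = refl
eqB-sym false false = refl

eqFin : ∀ {n} → Fin n → Fin n → Bool
eqFin i j = eqℕ (toℕ i) (toℕ j)

_⊆ᴳ_ : ∀ {k n} → Graph k → Graph n → Set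
_⊆ᴳ_ {k} {n} F G =
  Σ (Fin k → Fin n) λ f →
    Injective _≡_ _≡_ f × (∀ i j → adj F i j ≡ true → adj G (f i) (f j) ≡ true)

Free : ∀ {k n} → Graph k → Graph n → Set
Free F G = ¬ (F ⊆ᴳ G)

-- B_{r,0}: two vertex-disjoint copies of K_r, on vertex set Fin (r + r);
-- vertices i with toℕ i < r form one copy, the rest the other.

side : ∀ {m} → ℕ → Fin m → Bool
side r i = Data.Nat._<ᵇ_ (toℕ i) r

B : (r : ℕ) → Graph (r Data.Nat.+ r)
B r = record
  { adj = λ i j → eqB (side r i) (side r j) ∧ not (eqFin i j)
  ; sym = λ i j → cong₂ (λ a b → a ∧ not b)
                        (eqB-sym (side r i) (side r j)) (eqℕ-sym (toℕ i) (toℕ j))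
  ; irrefl = λ i → irr (eqB (side r i) (side r i)) (eqℕ-refl (toℕ i))
  }
  where
  irr : ∀ a {b} → b ≡ true → a ∧ not b ≡ false
  irr true refl = refl
  irr false refl = refl

-- Turán graph T_k(m): complete k-partite graph on Fin m, vertex i lying in
-- part (toℕ i mod k); part sizes then differ by at most one.
-- (For k = 0, which is never used, we put every vertex in its own part.)

part : ℕ → ℕ → ℕ
part zero x = x
part (suc k) x = x % suc k

turan : (k m : ℕ) → Graph m
turan k m = record
  { adj = λ i j → not (eqℕ (part k (toℕ i)) (part k (toℕ j)))
  ; sym = λ i j → Relation.Binary.PropositionalEquality.cong not
                    (eqℕ-sym (part k (toℕ i)) (part k (toℕ j)))
  ; irrefl = λ i → Relation.Binary.PropositionalEquality.cong not
                    (eqℕ-refl (part k (toℕ i)))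
  }

join1 : ∀ {m} → Graph m → Graph (suc m)
join1 {m} G = record { adj = a ; sym = s ; irrefl = ir }
  where
  a : Fin (suc m) → Fin (suc m) → Bool
  a zero zero = false
  a zero (suc _) = true
  a (suc _) zero = true
  a (suc i) (suc j) = adj G i j
  s : ∀ i j → a i j ≡ a j i
  s zero zero = refl
  s zero (suc _) = refl
  s (suc _) zero = refl
  s (suc i) (suc j) = sym G i j
  ir : ∀ i → a i i ≡ false
  ir zero = refl
  ir (suc i) = irrefl G i

allSubsets : (n : ℕ) → List (Vec Bool n)
allSubsets zero = [] ∷ []
allSubsets (suc n) = map (true ∷_) (allSubsets n) ++ map (false ∷_) (allSubsets n)

size : ∀ {n} → Vec Bool n → ℕ
size [] = 0
size (true ∷ s) = suc (size s)
size (false ∷ s) = size s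

allᵇ : ∀ {A : Set} → (A → Bool) → List A → Bool
allᵇ p [] = true
allᵇ p (x ∷ xs) = p x ∧ allᵇ p xs

isClique : ∀ {n} → Graph n → Vec Bool n → Bool
isClique {n} G S =
  allᵇ (λ i → allᵇ (λ j → not (lookup S i ∧ lookup S j ∧ not (eqFin i j)) ∨ adj G i j)
                 (allFin n))
      (allFin n)

copiesK : ∀ {n} → ℕ → Graph n → ℕ
copiesK {n} r G = length (filterᵇ (λ S → (size S ≡ᵇ r) ∧ isClique G S) (allSubsets n))

_≅ᴳ_ : ∀ {n m} → Graph n → Graph m → Set
_≅ᴳ_ {n} {m} G H =
  Σ (Fin n → Fin m) λ f → Σ (Fin m → Fin n) λ g →
    (∀ x → g (f x) ≡ x) × (∀ y → f (g y) ≡ y) ×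
    (∀ i j → adj G i j ≡ adj H (f i) (f j))

{-# OPTIONS --safe #-}

-- If some vertex v lies in every K_r, then the K_r's of G are the K_{r-1}'s in the
-- neighbourhood of v, and G - v is K_r-free, so the problem becomes Zykov's theorem
-- for K_{r-1}'s in K_r-free graphs on n - 1 vertices. Zykov's theorem is proved by
-- Erdős's induction through the neighbourhood of a vertex in the most cliques, which
-- bounds the count by a product of part sizes; a tangent inequality shows that this
-- product is largest exactly when the parts are balanced.
-- If there is no such v, fix a K_r, say C, and for each u in C a K_r avoiding u, say
-- D_u. Every K_r meets C in some u and also meets D_u, so it contains one of r² pairs,
-- and there are only O(n^(r-2)) copies, fewer than the order n^(r-1) of the Turán count.

module Submission where

open import Defs
open import Data.Bool using (Bool; true; false; not; _∧_; _∨_; if_then_else_)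
open import Data.Bool.Properties using (∧-conicalˡ; ∧-conicalʳ; ∧-zeroʳ; not-injective; ¬-not; not-¬; ⇔→≡)
open import Data.Fin using (Fin; zero; suc; toℕ; fromℕ<; punchOut; _↑ˡ_; _↑ʳ_; splitAt; join)
import Data.Fin.Properties as Finₚ
open import Data.List using (List; []; _∷_; map; _++_; length; filterᵇ; tabulate)
open import Data.Nat
  using (ℕ; zero; suc; _+_; _*_; _^_; _∸_; _≤_; _<_; z≤n; s≤s; z<s; s≤s⁻¹; _≡ᵇ_; NonZero; >-nonZero; >-nonZero⁻¹)
open import Data.Nat.DivMod
  using (_/_; _%_; _mod_; [m+kn]%n≡m%n; m<n⇒m%n≡m; m%n<n; m≡m%n+[m/n]*n; /-monoˡ-≤; m*n/n≡m)
open import Data.Nat.Properties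
open import Data.Nat.Tactic.RingSolver using (solve-∀)
open import Data.Product using (Σ-syntax; ∃-syntax; _×_; _,_; proj₁; proj₂)
open import Data.Sum using (_⊎_; inj₁; inj₂; [_,_]′)
open import Data.Vec using (Vec; []; _∷_; lookup)
import Data.Vec.Functional as F
open import Function using (_∘_)
open import Function.Bundles using (mk⇔)
open import Relation.Nullary using (¬_; Dec; yes; no; does; contradiction; _×-dec_)
open import Relation.Nullary.Decidable using (dec-true; dec-false)
open import Relation.Binary.PropositionalEquality
  using (_≡_; _≢_; refl; trans; cong; cong₂; subst; subst₂) renaming (sym to ≡-sym)

open ≤-Reasoning

-- The demand for uniqueness shapes the induction. Zykov's theorem is set up to return part sizes
-- `a` that depend on the graph, the bound by `prodF a`, and a complete partite structure promised
-- only when that bound is attained and positive: a zero product says nothing about the edges.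
-- Whether `a` is balanced then becomes a question about numbers alone. It is settled by one
-- inequality for each part size. The products of the upper bounds depend only on the sum of the
-- sizes, so no vertex has to be moved between parts, and equality can be read off part by part. A
-- last use of equality shows that the common vertex of all cliques sees every other vertex: each
-- vertex of the extremal partite graph lies in a largest clique, so a non-neighbour would cost at
-- least one clique.

private variable
  n k l r : ℕ
  X Y : Set

-- Subsets and clique counts

eqℕ⇒≡ : ∀ m n → eqℕ m n ≡ true → m ≡ n
eqℕ⇒≡ zero    zero    _ = refl
eqℕ⇒≡ (suc m) (suc n) e = cong suc (eqℕ⇒≡ m n e)

eqFin⇒≡ : (x y : Fin n) → eqFin x y ≡ true → x ≡ y
eqFin⇒≡ x y e = Finₚ.toℕ-injective (eqℕ⇒≡ (toℕ x) (toℕ y) e)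

eqFin-refl : (x : Fin n) → eqFin x x ≡ true
eqFin-refl x = eqℕ-refl (toℕ x)

Subset : ℕ → Set
Subset n = Fin n → Bool

infix  4 _∈_ _∉_ _⊆_ _∈?_
infixl 7 _∩_
infixl 6 _-_

-- A record, so that the subset can be inferred from a membership proof.
record _∈_ (x : Fin n) (P : Subset n) : Set where
  constructor mem
  field holds : P x ≡ true
open _∈_

_∉_ : Fin n → Subset n → Set
x ∉ P = ¬ x ∈ P

_⊆_ : Subset n → Subset n → Set
P ⊆ Q = ∀ {x} → x ∈ P → x ∈ Q

_∈?_ : (x : Fin n) (P : Subset n) → Dec (x ∈ P)
x ∈? P with P x in e
... | true  = yes (mem e)
... | false = no λ x∈P → contradiction (holds x∈P) (not-¬ e)

∉⇒false : {x : Fin n} {P : Subset n} → x ∉ P → P x ≡ false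
∉⇒false x∉P = ¬-not (x∉P ∘ mem)

false⇒∉ : {x : Fin n} {P : Subset n} → P x ≡ false → x ∉ P
false⇒∉ e (mem t) = not-¬ e t

-- Opaque, so that unification recovers P and Q from P ∩ Q, and likewise below.
opaque
  _∩_ : Subset n → Subset n → Subset n
  (P ∩ Q) x = P x ∧ Q x

  ∁ : Subset n → Subset n
  ∁ P x = not (P x)

  _-_ : Subset n → Fin n → Subset n
  (P - x) y = P y ∧ not (eqFin y x)

  tail : Subset (suc n) → Subset n
  tail P x = P (suc x)

  ∉⇒∈∁ : {P : Subset n} {x : Fin n} → x ∉ P → x ∈ ∁ P
  ∉⇒∈∁ x∉P = mem (cong not (∉⇒false x∉P))

  ∈∁⇒∉ : {P : Subset n} {x : Fin n} → x ∈ ∁ P → x ∉ P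
  ∈∁⇒∉ (mem e) = false⇒∉ (not-injective e)

  ∈-∩ : {P Q : Subset n} {x : Fin n} → x ∈ P → x ∈ Q → x ∈ P ∩ Q
  ∈-∩ (mem p) (mem q) = mem (cong₂ _∧_ p q)

  ∩-⊆ˡ : {P Q : Subset n} → P ∩ Q ⊆ P
  ∩-⊆ˡ (mem pq) = mem (∧-conicalˡ _ _ pq)

  ∩-⊆ʳ : {P Q : Subset n} → P ∩ Q ⊆ Q
  ∩-⊆ʳ (mem pq) = mem (∧-conicalʳ _ _ pq)

  ∈-remove : {P : Subset n} {x y : Fin n} → y ∈ P → y ≢ x → y ∈ P - x
  ∈-remove (mem y∈P) y≢x = mem (cong₂ _∧_ y∈P (cong not (¬-not (y≢x ∘ eqFin⇒≡ _ _))))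

  remove-⊆ : {P : Subset n} {x : Fin n} → P - x ⊆ P
  remove-⊆ (mem y∈) = mem (∧-conicalˡ _ _ y∈)

  remove-≢ : {P : Subset n} {x y : Fin n} → y ∈ P - x → y ≢ x
  remove-≢ {y = y} (mem y∈) refl = not-¬ (not-injective (∧-conicalʳ _ _ y∈)) (eqFin-refl y)

  tail⁺ : {P : Subset (suc n)} {x : Fin n} → suc x ∈ P → x ∈ tail P
  tail⁺ (mem e) = mem e

  tail⁻ : {P : Subset (suc n)} {x : Fin n} → x ∈ tail P → suc x ∈ P
  tail⁻ (mem e) = mem e

⊤ : Subset n
⊤ _ = true

∈⊤ : {x : Fin n} → x ∈ ⊤
∈⊤ = mem refl

∩-mono : {P Q R S : Subset n} → P ⊆ Q → R ⊆ S → P ∩ R ⊆ Q ∩ S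
∩-mono P⊆Q R⊆S x∈ = ∈-∩ (P⊆Q (∩-⊆ˡ x∈)) (R⊆S (∩-⊆ʳ x∈))

∩-monoˡ : {P Q R : Subset n} → P ⊆ Q → P ∩ R ⊆ Q ∩ R
∩-monoˡ P⊆Q = ∩-mono P⊆Q (λ x∈ → x∈)

∩-swap : {P Q R : Subset n} → (P ∩ Q) ∩ R ⊆ (P ∩ R) ∩ Q
∩-swap x∈ = ∈-∩ (∩-monoˡ ∩-⊆ˡ x∈) (∩-⊆ʳ (∩-⊆ˡ x∈))

remove-mono : {P Q : Subset n} {x : Fin n} → P ⊆ Q → P - x ⊆ Q - x
remove-mono P⊆Q y∈ = ∈-remove (P⊆Q (remove-⊆ y∈)) (remove-≢ y∈)

tail-mono : {P Q : Subset (suc n)} → P ⊆ Q → tail P ⊆ tail Q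
tail-mono P⊆Q x∈ = tail⁺ (P⊆Q (tail⁻ x∈))

tail-remove-zero : {P : Subset (suc n)} → tail P ⊆ tail (P - zero)
tail-remove-zero x∈ = tail⁺ (∈-remove (tail⁻ x∈) λ ())

tail-remove-suc : {P : Subset (suc n)} {x : Fin n} → tail (P - suc x) ⊆ tail P - x
tail-remove-suc y∈ = ∈-remove (tail-mono remove-⊆ y∈) (remove-≢ (tail⁻ y∈) ∘ cong suc)

remove-suc-tail : {P : Subset (suc n)} {x : Fin n} → tail P - x ⊆ tail (P - suc x)
remove-suc-tail y∈ = tail⁺ (∈-remove (tail⁻ (remove-⊆ y∈)) (remove-≢ y∈ ∘ Finₚ.suc-injective))

tail-∩ : {P Q : Subset (suc n)} → tail (P ∩ Q) ⊆ tail P ∩ tail Q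
tail-∩ x∈ = ∈-∩ (tail-mono ∩-⊆ˡ x∈) (tail-mono ∩-⊆ʳ x∈)

∩-tail : {P Q : Subset (suc n)} → tail P ∩ tail Q ⊆ tail (P ∩ Q)
∩-tail x∈ = tail⁺ (∈-∩ (tail⁻ (∩-⊆ˡ x∈)) (tail⁻ (∩-⊆ʳ x∈)))

count : Subset n → ℕ
count {zero}  P = 0
count {suc n} P = (if P zero then 1 else 0) + count (tail P)

if-mono : ∀ {P Q : Subset n} {x a b} → (x ∈ P → x ∈ Q) → (x ∈ P → a ≤ b) →
  (if P x then a else 0) ≤ (if Q x then b else 0)
if-mono {P = P} {Q} {x} p⇒q a≤b with P x in e
... | false = z≤n
... | true  rewrite holds (p⇒q (mem e)) = a≤b (mem e)

count-mono : (P Q : Subset n) → P ⊆ Q → count P ≤ count Q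
count-mono {zero}  P Q P⊆Q = z≤n
count-mono {suc n} P Q P⊆Q =
  +-mono-≤ (if-mono {P = P} {Q} P⊆Q (λ _ → ≤-refl)) (count-mono (tail P) (tail Q) (tail-mono P⊆Q))

count-cong : (P Q : Subset n) → P ⊆ Q → Q ⊆ P → count P ≡ count Q
count-cong P Q P⊆Q Q⊆P = ≤-antisym (count-mono P Q P⊆Q) (count-mono Q P Q⊆P)

count-zero∈ : (P : Subset (suc n)) → zero ∈ P → count P ≡ suc (count (tail P))
count-zero∈ P (mem e) rewrite e = refl

count-zero∉ : (P : Subset (suc n)) → zero ∉ P → count P ≡ count (tail P)
count-zero∉ P 0∉P rewrite ∉⇒false 0∉P = refl

count-remove : (P : Subset n) {x : Fin n} → x ∈ P → count P ≡ suc (count (P - x))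
count-remove {suc n} P {zero} 0∈P = trans (count-zero∈ P 0∈P)
  (cong suc (trans (count-cong (tail P) (tail (P - zero)) tail-remove-zero (tail-mono remove-⊆))
                   (≡-sym (count-zero∉ (P - zero) (λ z → remove-≢ z refl)))))
count-remove {suc n} P {suc x} x∈P with zero ∈? P
... | yes 0∈P = trans (count-zero∈ P 0∈P) (cong suc (trans (count-remove (tail P) (tail⁺ x∈P))
  (trans (cong suc (count-cong (tail P - x) (tail (P - suc x)) remove-suc-tail tail-remove-suc))
         (≡-sym (count-zero∈ (P - suc x) (∈-remove 0∈P λ ()))))))
... | no 0∉P = trans (count-zero∉ P 0∉P) (trans (count-remove (tail P) (tail⁺ x∈P))
  (cong suc (trans (count-cong (tail P - x) (tail (P - suc x)) remove-suc-tail tail-remove-suc)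
                   (≡-sym (count-zero∉ (P - suc x) (0∉P ∘ remove-⊆))))))

count≡0⇒∉ : {P : Subset n} {x : Fin n} → count P ≡ 0 → x ∉ P
count≡0⇒∉ e x∈P = 1+n≢0 (trans (≡-sym (count-remove _ x∈P)) e)

count>0⇒∈ : (P : Subset n) → 0 < count P → ∃[ x ] x ∈ P
count>0⇒∈ {suc n} P 0<c with P zero in e
... | true  = zero , mem e
... | false with x , x∈P ← count>0⇒∈ (tail P) 0<c = suc x , tail⁻ x∈P

count-⊤ : ∀ n → count (⊤ {n}) ≡ n
count-⊤ zero    = refl
count-⊤ (suc n) = cong suc (trans (count-cong {n} (tail ⊤) ⊤ (λ _ → ∈⊤) (λ _ → tail⁺ ∈⊤)) (count-⊤ n))

count≤n : (P : Subset n) → count P ≤ n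
count≤n {n} P = subst (count P ≤_) (count-⊤ n) (count-mono P ⊤ (λ _ → ∈⊤))

tailᴳ : Graph (suc n) → Graph n
tailᴳ G = record
  { adj    = λ i j → adj G (suc i) (suc j)
  ; sym    = λ i j → sym G (suc i) (suc j)
  ; irrefl = λ i → irrefl G (suc i)
  }

adj-sym : (G : Graph n) {x y : Fin n} → y ∈ adj G x → x ∈ adj G y
adj-sym G {x} {y} (mem e) = mem (trans (sym G y x) e)

adj-irrefl : (G : Graph n) {x : Fin n} → x ∉ adj G x
adj-irrefl G {x} = false⇒∉ (irrefl G x)

∩-tail-adj : (G : Graph (suc n)) {P : Subset (suc n)} {x : Fin n} →
  tail P ∩ adj (tailᴳ G) x ⊆ tail (P ∩ adj G (suc x))
∩-tail-adj G y∈ = tail⁺ (∈-∩ (tail⁻ (∩-⊆ˡ y∈)) (mem (holds (∩-⊆ʳ y∈))))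

tail-∩-adj : (G : Graph (suc n)) {P : Subset (suc n)} {x : Fin n} →
  tail (P ∩ adj G (suc x)) ⊆ tail P ∩ adj (tailᴳ G) x
tail-∩-adj G y∈ = ∈-∩ (tail-mono ∩-⊆ˡ y∈) (mem (holds (∩-⊆ʳ (tail⁻ y∈))))

cliques : Graph n → ℕ → Subset n → ℕ
cliques         G zero    P = 1
cliques {zero}  G (suc k) P = 0
cliques {suc n} G (suc k) P =
  (if P zero then cliques (tailᴳ G) k (tail P ∩ tail (adj G zero)) else 0) + cliques (tailᴳ G) (suc k) (tail P)

cliques-mono : (G : Graph n) (k : ℕ) {P Q : Subset n} → P ⊆ Q → cliques G k P ≤ cliques G k Q
cliques-mono         G zero    P⊆Q = ≤-refl
cliques-mono {zero}  G (suc k) P⊆Q = ≤-refl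
cliques-mono {suc n} G (suc k) {P} {Q} P⊆Q = +-mono-≤
  (if-mono {P = P} {Q} P⊆Q λ _ → cliques-mono (tailᴳ G) k (∩-monoˡ (tail-mono P⊆Q)))
  (cliques-mono (tailᴳ G) (suc k) (tail-mono P⊆Q))

cliques-cong : (G : Graph n) (k : ℕ) {P Q : Subset n} → P ⊆ Q → Q ⊆ P → cliques G k P ≡ cliques G k Q
cliques-cong G k P⊆Q Q⊆P = ≤-antisym (cliques-mono G k P⊆Q) (cliques-mono G k Q⊆P)

cliques-zero∈ : (G : Graph (suc n)) (k : ℕ) (P : Subset (suc n)) → zero ∈ P →
  cliques G (suc k) P ≡
    cliques (tailᴳ G) k (tail P ∩ tail (adj G zero)) + cliques (tailᴳ G) (suc k) (tail P)
cliques-zero∈ G k P (mem e) rewrite e = refl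

cliques-zero∉ : (G : Graph (suc n)) (k : ℕ) (P : Subset (suc n)) → zero ∉ P →
  cliques G k P ≡ cliques (tailᴳ G) k (tail P)
cliques-zero∉ G zero    P 0∉P = refl
cliques-zero∉ G (suc k) P 0∉P rewrite ∉⇒false 0∉P = refl

-- The double counting identity from which all later estimates follow.
cliques-remove : (G : Graph n) (k : ℕ) (P : Subset n) {x : Fin n} → x ∈ P →
  cliques G (suc k) P ≡ cliques G (suc k) (P - x) + cliques G k (P ∩ adj G x)
cliques-remove {suc n} G k P {zero} x∈P = begin-equality
  cliques G (suc k) P
    ≡⟨ cliques-zero∈ G k P x∈P ⟩
  cliques G′ k (tail P ∩ tail (adj G zero)) + cliques G′ (suc k) (tail P)
    ≡⟨ +-comm (cliques G′ k (tail P ∩ tail (adj G zero))) _ ⟩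
  cliques G′ (suc k) (tail P) + cliques G′ k (tail P ∩ tail (adj G zero))
    ≡⟨ cong₂ _+_ (cliques-cong G′ (suc k) tail-remove-zero (tail-mono remove-⊆))
                 (cliques-cong G′ k ∩-tail tail-∩) ⟩
  cliques G′ (suc k) (tail (P - zero)) + cliques G′ k (tail (P ∩ adj G zero))
    ≡⟨ cong₂ _+_ (cliques-zero∉ G (suc k) (P - zero) (λ z → remove-≢ z refl))
                 (cliques-zero∉ G k (P ∩ adj G zero) (adj-irrefl G ∘ ∩-⊆ʳ)) ⟨
  cliques G (suc k) (P - zero) + cliques G k (P ∩ adj G zero) ∎
  where
  G′ = tailᴳ G
cliques-remove {suc n} G k P {suc x} x∈P with zero ∈? P
... | no 0∉P = begin-equality
  cliques G (suc k) P
    ≡⟨ cliques-zero∉ G (suc k) P 0∉P ⟩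
  cliques G′ (suc k) (tail P)
    ≡⟨ cliques-remove G′ k (tail P) (tail⁺ x∈P) ⟩
  cliques G′ (suc k) (tail P - x) + cliques G′ k (tail P ∩ adj G′ x)
    ≡⟨ cong₂ _+_ (cliques-cong G′ (suc k) remove-suc-tail tail-remove-suc)
                 (cliques-cong G′ k (∩-tail-adj G) (tail-∩-adj G)) ⟩
  cliques G′ (suc k) (tail (P - suc x)) + cliques G′ k (tail (P ∩ adj G (suc x)))
    ≡⟨ cong₂ _+_ (cliques-zero∉ G (suc k) (P - suc x) (0∉P ∘ remove-⊆))
                 (cliques-zero∉ G k (P ∩ adj G (suc x)) (0∉P ∘ ∩-⊆ˡ)) ⟨
  cliques G (suc k) (P - suc x) + cliques G k (P ∩ adj G (suc x)) ∎
  where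
  G′ = tailᴳ G
... | yes 0∈P = begin-equality
  cliques G (suc k) P
    ≡⟨ cliques-zero∈ G k P 0∈P ⟩
  cliques G′ k (tail P ∩ N₀) + cliques G′ (suc k) (tail P)
    ≡⟨ cong (cliques G′ k (tail P ∩ N₀) +_) (cliques-remove G′ k (tail P) (tail⁺ x∈P)) ⟩
  cliques G′ k (tail P ∩ N₀) + (cliques G′ (suc k) (tail P - x) + cliques G′ k (tail P ∩ adj G′ x))
    ≡⟨ +-exchange (cliques G′ k (tail P ∩ N₀)) (cliques G′ (suc k) (tail P - x)) _ ⟩
  cliques G′ (suc k) (tail P - x) + (cliques G′ k (tail P ∩ N₀) + cliques G′ k (tail P ∩ adj G′ x))
    ≡⟨ cong₂ _+_ (cliques-cong G′ (suc k) remove-suc-tail tail-remove-suc) (through-zero k) ⟩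
  cliques G′ (suc k) (tail (P - suc x)) + (cliques G′ k (tail (P - suc x) ∩ N₀) + cliques G k (P ∩ adj G (suc x)))
    ≡⟨ trans (+-exchange (cliques G′ (suc k) (tail (P - suc x))) (cliques G′ k (tail (P - suc x) ∩ N₀)) _) (≡-sym (+-assoc (cliques G′ k (tail (P - suc x) ∩ N₀)) _ _)) ⟩
  (cliques G′ k (tail (P - suc x) ∩ N₀) + cliques G′ (suc k) (tail (P - suc x))) + cliques G k (P ∩ adj G (suc x))
    ≡⟨ cong (_+ cliques G k (P ∩ adj G (suc x))) (cliques-zero∈ G k (P - suc x) (∈-remove 0∈P λ ())) ⟨
  cliques G (suc k) (P - suc x) + cliques G k (P ∩ adj G (suc x)) ∎
  where
  G′ = tailᴳ G
  N₀ = tail (adj G zero)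
  +-exchange : ∀ a b c → a + (b + c) ≡ b + (a + c)
  +-exchange a b c = trans (≡-sym (+-assoc a b c)) (trans (cong (_+ c) (+-comm a b)) (+-assoc b a c))
  -- The cliques through `zero` and those through `suc x` overlap in the ones through both, which
  -- exist only if the two vertices are adjacent; hence the case split. In the adjacent case the
  -- common cliques move from the first count to the second.
  through-zero : ∀ k → cliques G′ k (tail P ∩ N₀) + cliques G′ k (tail P ∩ adj G′ x) ≡
    cliques G′ k (tail (P - suc x) ∩ N₀) + cliques G k (P ∩ adj G (suc x))
  through-zero zero = refl
  through-zero (suc k) with suc x ∈? adj G zero
  ... | no x∉N₀ = cong₂ _+_
    (cliques-cong G′ (suc k)
      (λ y∈ → ∈-∩ (remove-suc-tail (∈-remove (∩-⊆ˡ y∈) λ { refl → x∉N₀ (tail⁻ (∩-⊆ʳ y∈)) })) (∩-⊆ʳ y∈))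
      (∩-monoˡ (tail-mono remove-⊆)))
    (trans (cliques-cong G′ (suc k) (∩-tail-adj G) (tail-∩-adj G))
           (≡-sym (cliques-zero∉ G (suc k) (P ∩ adj G (suc x)) (x∉N₀ ∘ adj-sym G ∘ ∩-⊆ʳ))))
  ... | yes x∈N₀ = begin-equality
    cliques G′ (suc k) (tail P ∩ N₀) + cliques G′ (suc k) (tail P ∩ adj G′ x)
      ≡⟨ cong (_+ cliques G′ (suc k) (tail P ∩ adj G′ x))
           (cliques-remove G′ k (tail P ∩ N₀) (∈-∩ (tail⁺ x∈P) (tail⁺ x∈N₀))) ⟩
    (cliques G′ (suc k) (tail P ∩ N₀ - x) + cliques G′ k (tail P ∩ N₀ ∩ adj G′ x))
      + cliques G′ (suc k) (tail P ∩ adj G′ x)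
      ≡⟨ +-assoc (cliques G′ (suc k) (tail P ∩ N₀ - x)) _ _ ⟩
    cliques G′ (suc k) (tail P ∩ N₀ - x)
      + (cliques G′ k (tail P ∩ N₀ ∩ adj G′ x) + cliques G′ (suc k) (tail P ∩ adj G′ x))
      ≡⟨ cong₂ _+_
           (cliques-cong G′ (suc k)
             (λ y∈ → ∈-∩ (remove-suc-tail (remove-mono ∩-⊆ˡ y∈)) (∩-⊆ʳ (remove-⊆ y∈)))
             (λ y∈ → ∈-remove (∩-monoˡ (tail-mono remove-⊆) y∈) (remove-≢ (tail-remove-suc (∩-⊆ˡ y∈)))))
           (cong₂ _+_
             (cliques-cong G′ k
               (λ y∈ → ∩-monoˡ (∩-tail-adj G) (∩-swap y∈)) (λ y∈ → ∩-swap (∩-monoˡ (tail-∩-adj G) y∈)))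
             (cliques-cong G′ (suc k) (∩-tail-adj G) (tail-∩-adj G))) ⟩
    cliques G′ (suc k) (tail (P - suc x) ∩ N₀)
      + (cliques G′ k (tail (P ∩ adj G (suc x)) ∩ N₀) + cliques G′ (suc k) (tail (P ∩ adj G (suc x))))
      ≡⟨ cong (cliques G′ (suc k) (tail (P - suc x) ∩ N₀) +_)
           (cliques-zero∈ G k (P ∩ adj G (suc x)) (∈-∩ 0∈P (adj-sym G x∈N₀))) ⟨
    cliques G′ (suc k) (tail (P - suc x) ∩ N₀) + cliques G (suc k) (P ∩ adj G (suc x)) ∎

-- Counting bounds

cliques-extend : (G : Graph n) (k : ℕ) (P : Subset n) {x : Fin n} → x ∈ P →
  cliques G k (P ∩ adj G x) ≤ cliques G (suc k) P
cliques-extend G k P x∈P = ≤-trans (m≤n+m _ _) (≤-reflexive (≡-sym (cliques-remove G k P x∈P)))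

count-remove-∩∁ : (P A : Subset n) {u : Fin n} → u ∈ P ∩ ∁ A → count (P ∩ ∁ A) ≡ suc (count ((P - u) ∩ ∁ A))
count-remove-∩∁ P A {u} u∈ = trans (count-remove (P ∩ ∁ A) u∈)
  (cong suc (count-cong (P ∩ ∁ A - u) ((P - u) ∩ ∁ A)
    (λ x∈ → ∈-∩ (remove-mono ∩-⊆ˡ x∈) (∩-⊆ʳ (remove-⊆ x∈)))
    (λ x∈ → ∈-remove (∩-monoˡ remove-⊆ x∈) (remove-≢ (∩-⊆ˡ x∈)))))

count-∩∁≡0⇒⊆ : (P A : Subset n) → count (P ∩ ∁ A) ≡ 0 → P ⊆ P ∩ A
count-∩∁≡0⇒⊆ P A none {x} x∈P with x ∈? A
... | yes x∈A = ∈-∩ x∈P x∈A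
... | no  x∉A = contradiction (∈-∩ x∈P (∉⇒∈∁ x∉A)) (count≡0⇒∉ none)

count-split : (P A : Subset n) → count (P ∩ ∁ A) + count (P ∩ A) ≡ count P
count-split {n} P A = go (count (P ∩ ∁ A)) P refl
  where
  go : ∀ b P → count (P ∩ ∁ A) ≡ b → b + count (P ∩ A) ≡ count P
  go zero P none = count-cong (P ∩ A) P ∩-⊆ˡ (count-∩∁≡0⇒⊆ P A none)
  go (suc b) P some with u , u∈ ← count>0⇒∈ (P ∩ ∁ A) (subst (0 <_) (≡-sym some) z<s) =
    trans (cong suc (trans (cong (b +_) (count-cong (P ∩ A) ((P - u) ∩ A)
             (λ x∈ → ∈-∩ (∈-remove (∩-⊆ˡ x∈) λ { refl → ∈∁⇒∉ (∩-⊆ʳ u∈) (∩-⊆ʳ x∈) }) (∩-⊆ʳ x∈))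
             (∩-monoˡ remove-⊆)))
           (go b (P - u) (suc-injective (trans (≡-sym (count-remove-∩∁ P A u∈)) some)))))
          (≡-sym (count-remove P (∩-⊆ˡ u∈)))

-- The vertices of `P` outside `A` are deleted one by one, and a clique not inside `A` is charged to
-- the first deleted vertex that it contains. An empty `A` gives crude bounds; a neighbourhood gives
-- Erdős's step.
cliques-⊆∩ : (G : Graph n) (k : ℕ) (P A : Subset n) (D : ℕ) →
  (∀ {u} → u ∈ P → u ∉ A → cliques G k (P ∩ adj G u) ≤ D) →
  cliques G (suc k) P ≤ cliques G (suc k) (P ∩ A) + count (P ∩ ∁ A) * D
cliques-⊆∩ {n} G k P A D bound = go (count (P ∩ ∁ A)) P refl bound
  where
  go : ∀ b P → count (P ∩ ∁ A) ≡ b → (∀ {u} → u ∈ P → u ∉ A → cliques G k (P ∩ adj G u) ≤ D) →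
    cliques G (suc k) P ≤ cliques G (suc k) (P ∩ A) + b * D
  go zero P none _ = ≤-trans (cliques-mono G (suc k) (count-∩∁≡0⇒⊆ P A none)) (m≤m+n _ 0)
  go (suc b) P some bound with u , u∈ ← count>0⇒∈ (P ∩ ∁ A) (subst (0 <_) (≡-sym some) z<s) = begin
    cliques G (suc k) P
      ≡⟨ cliques-remove G k P (∩-⊆ˡ u∈) ⟩
    cliques G (suc k) (P - u) + cliques G k (P ∩ adj G u)
      ≤⟨ +-mono-≤ (go b (P - u) (suc-injective (trans (≡-sym (count-remove-∩∁ P A u∈)) some)) λ w∈ w∉ → ≤-trans (cliques-mono G k (∩-monoˡ remove-⊆)) (bound (remove-⊆ w∈) w∉))
                  (bound (∩-⊆ˡ u∈) (∈∁⇒∉ (∩-⊆ʳ u∈))) ⟩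
    cliques G (suc k) ((P - u) ∩ A) + b * D + D
      ≡⟨ trans (+-assoc _ (b * D) D) (cong (cliques G (suc k) ((P - u) ∩ A) +_) (+-comm (b * D) D)) ⟩
    cliques G (suc k) ((P - u) ∩ A) + suc b * D
      ≤⟨ +-monoˡ-≤ (suc b * D) (cliques-mono G (suc k) (∩-monoˡ remove-⊆)) ⟩
    cliques G (suc k) (P ∩ A) + suc b * D ∎

-- A vertex adjacent to all of `A` lies outside `A`. So `A` survives intact while the vertices of
-- `C` are removed from `P` one at a time, and each of them accounts for its own `cliques G k A`
-- cliques.
complete-≤-cliques : (G : Graph n) (k : ℕ) (P A C : Subset n) → A ⊆ P → C ⊆ P →
  (∀ {u} → u ∈ C → A ⊆ adj G u) → count C * cliques G k A ≤ cliques G (suc k) P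
complete-≤-cliques {n} G k P A C A⊆P C⊆P complete = go (count C) P C refl A⊆P C⊆P complete
  where
  go : ∀ b P C → count C ≡ b → A ⊆ P → C ⊆ P → (∀ {u} → u ∈ C → A ⊆ adj G u) →
    b * cliques G k A ≤ cliques G (suc k) P
  go zero P C _ _ _ _ = z≤n
  go (suc b) P C some A⊆P C⊆P complete with u , u∈C ← count>0⇒∈ C (subst (0 <_) (≡-sym some) z<s) = begin
    cliques G k A + b * cliques G k A
      ≤⟨ +-mono-≤ (cliques-mono G k λ x∈A → ∈-∩ (A⊆P x∈A) (complete u∈C x∈A))
           (go b (P - u) (C - u) (suc-injective (trans (≡-sym (count-remove C u∈C)) some))
             (λ x∈A → ∈-remove (A⊆P x∈A) λ { refl → adj-irrefl G (complete u∈C x∈A) })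
             (remove-mono C⊆P) (complete ∘ remove-⊆)) ⟩
    cliques G k (P ∩ adj G u) + cliques G (suc k) (P - u)
      ≡⟨ trans (+-comm (cliques G k (P ∩ adj G u)) _) (≡-sym (cliques-remove G k P (C⊆P u∈C))) ⟩
    cliques G (suc k) P ∎

cliques-∅ : (G : Graph n) (k : ℕ) (P : Subset n) → (∀ {x} → x ∉ P) → cliques G (suc k) P ≡ 0
cliques-∅ {zero}  G k P ∅ = refl
cliques-∅ {suc n} G k P ∅ = trans (cliques-zero∉ G (suc k) P ∅) (cliques-∅ (tailᴳ G) k (tail P) (∅ ∘ tail⁻))

cliques-one : (G : Graph n) (P : Subset n) → cliques G 1 P ≡ count P
cliques-one {zero}  G P = refl
cliques-one {suc n} G P = cong ((if P zero then 1 else 0) +_) (cliques-one (tailᴳ G) (tail P))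

cliques≤^ : (G : Graph n) (k : ℕ) (P : Subset n) → cliques G k P ≤ n ^ k
cliques≤^ G zero P = ≤-refl
cliques≤^ {n} G (suc k) P = begin
  cliques G (suc k) P
    ≤⟨ cliques-⊆∩ G k P (∁ ⊤) (n ^ k) (λ _ _ → cliques≤^ G k _) ⟩
  cliques G (suc k) (P ∩ ∁ ⊤) + count (P ∩ ∁ (∁ ⊤)) * n ^ k
    ≡⟨ cong (_+ count (P ∩ ∁ (∁ ⊤)) * n ^ k) (cliques-∅ G k (P ∩ ∁ ⊤) λ x∈ → ∈∁⇒∉ (∩-⊆ʳ x∈) ∈⊤) ⟩
  count (P ∩ ∁ (∁ ⊤)) * n ^ k
    ≤⟨ *-monoˡ-≤ (n ^ k) (count≤n (P ∩ ∁ (∁ ⊤))) ⟩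
  n * n ^ k ∎

-- If no vertex had a positive count, the union bound with `D = 0` and an empty `A` would leave no
-- clique.
cliques>0⇒∃ : (G : Graph n) (k : ℕ) (P : Subset n) → 0 < cliques G (suc k) P →
  ∃[ x ] x ∈ P × 0 < cliques G k (P ∩ adj G x)
cliques>0⇒∃ G k P 0<c with Finₚ.any? (λ x → (x ∈? P) ×-dec (0 <? cliques G k (P ∩ adj G x)))
... | yes found = found
... | no none = contradiction 0<c (≤⇒≯ (begin
  cliques G (suc k) P
    ≤⟨ cliques-⊆∩ G k P (∁ ⊤) 0 (λ u∈P _ → ≮⇒≥ λ 0<c′ → none (_ , u∈P , 0<c′)) ⟩
  cliques G (suc k) (P ∩ ∁ ⊤) + count (P ∩ ∁ (∁ ⊤)) * 0
    ≡⟨ cong₂ _+_ (cliques-∅ G k (P ∩ ∁ ⊤) λ x∈ → ∈∁⇒∉ (∩-⊆ʳ x∈) ∈⊤) (*-zeroʳ (count (P ∩ ∁ (∁ ⊤)))) ⟩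
  0 ∎))

record CliqueIn (G : Graph n) (k : ℕ) (P : Subset n) : Set where
  field
    vertex   : Fin k → Fin n
    within   : ∀ i → vertex i ∈ P
    adjacent : ∀ {i j} → i ≢ j → vertex j ∈ adj G (vertex i)

  vertex-injective : ∀ {i j} → vertex i ≡ vertex j → i ≡ j
  vertex-injective {i} {j} e with i Finₚ.≟ j
  ... | yes i≡j = i≡j
  ... | no  i≢j = contradiction (subst (_∈ adj G (vertex i)) (≡-sym e) (adjacent i≢j)) (adj-irrefl G)

cliques>0⇒CliqueIn : (G : Graph n) (k : ℕ) (P : Subset n) → 0 < cliques G k P → CliqueIn G k P
cliques>0⇒CliqueIn G zero P _ = record { vertex = λ () ; within = λ () ; adjacent = λ { {()} } }
cliques>0⇒CliqueIn {n} G (suc k) P 0<c with x , x∈P , 0<c′ ← cliques>0⇒∃ G k P 0<c =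
  record { vertex = v ; within = w ; adjacent = a }
  where
  K = cliques>0⇒CliqueIn G k (P ∩ adj G x) 0<c′
  open CliqueIn K
  v : Fin (suc k) → Fin n
  v zero    = x
  v (suc i) = vertex i
  w : ∀ i → v i ∈ P
  w zero    = x∈P
  w (suc i) = ∩-⊆ˡ (within i)
  a : ∀ {i j} → i ≢ j → v j ∈ adj G (v i)
  a {zero}  {zero}  i≢j = contradiction refl i≢j
  a {zero}  {suc j} i≢j = ∩-⊆ʳ (within j)
  a {suc i} {zero}  i≢j = adj-sym G (∩-⊆ʳ (within i))
  a {suc i} {suc j} i≢j = adjacent (i≢j ∘ cong suc)

sumF prodF : (Fin k → ℕ) → ℕ
sumF  {zero}  a = 0
sumF  {suc k} a = a zero + sumF (a ∘ suc)
prodF {zero}  a = 1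
prodF {suc k} a = a zero * prodF (a ∘ suc)

sumF-zero : ∀ k → sumF {k} (λ _ → 0) ≡ 0
sumF-zero zero    = refl
sumF-zero (suc k) = sumF-zero k

opaque
  fibre : (Fin n → Fin k) → Fin k → Subset n
  fibre c j x = eqFin (c x) j

  ∈-fibre : {c : Fin n → Fin k} {j : Fin k} {x : Fin n} → c x ≡ j → x ∈ fibre c j
  ∈-fibre {c = c} {x = x} refl = mem (eqFin-refl (c x))

  fibre⇒≡ : {c : Fin n → Fin k} {j : Fin k} {x : Fin n} → x ∈ fibre c j → c x ≡ j
  fibre⇒≡ {c = c} {j} {x} (mem e) = eqFin⇒≡ (c x) j e

maximum : (P : Subset n) (g : Fin n → ℕ) → {u : Fin n} → u ∈ P → ∃[ v ] v ∈ P × (∀ {x} → x ∈ P → g x ≤ g v)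
maximum {suc n} P g {u} u∈P with Finₚ.any? (_∈? tail P)
... | no none = u , u∈P , λ x∈P → ≤-reflexive (cong g (trans (only-zero x∈P) (≡-sym (only-zero u∈P))))
  where
  only-zero : ∀ {x} → x ∈ P → x ≡ zero
  only-zero {zero}  _   = refl
  only-zero {suc x} x∈P = contradiction (_ , tail⁺ x∈P) none
... | yes (w , w∈) with v , v∈ , max ← maximum (tail P) (g ∘ suc) w∈ with zero ∈? P | g zero ≤? g (suc v)
... | yes 0∈P | no  0≰v = zero , 0∈P , λ { {zero} _ → ≤-refl ; {suc x} x∈P → ≤-trans (max (tail⁺ x∈P)) (≰⇒≥ 0≰v) }
... | _       | yes 0≤v = suc v , tail⁻ v∈ , λ { {zero} _ → 0≤v ; {suc x} x∈P → max (tail⁺ x∈P) }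
... | no 0∉P  | _       = suc v , tail⁻ v∈ , λ { {zero} 0∈P → contradiction 0∈P 0∉P ; {suc x} x∈P → max (tail⁺ x∈P) }

-- The field `extends` puts every vertex of `P` in a clique on `suc k` vertices. Deleting any vertex
-- therefore lowers the clique count strictly, which is how missing edges are refuted.
record CompletePartite (G : Graph n) (P : Subset n) (a : Fin (suc k) → ℕ) : Set where
  field
    colour  : Fin n → Fin (suc k)
    same    : ∀ {x y} → x ∈ P → y ∈ P → colour x ≡ colour y → y ∉ adj G x
    differ  : ∀ {x y} → x ∈ P → y ∈ P → colour x ≢ colour y → y ∈ adj G x
    sizes   : ∀ j → count (P ∩ fibre colour j) ≡ a j
    extends : ∀ {x} → x ∈ P → 0 < cliques G k (P ∩ adj G x)

-- Zykov's theorem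

∈-∩∁-cases : {P A : Subset n} {x : Fin n} → x ∈ P → x ∈ P ∩ A ⊎ x ∈ P ∩ ∁ A
∈-∩∁-cases {A = A} {x} x∈P with x ∈? A
... | yes x∈A = inj₁ (∈-∩ x∈P x∈A)
... | no  x∉A = inj₂ (∈-∩ x∈P (∉⇒∈∁ x∉A))

-- The equality case of Erdős's step. `A` stands for the neighbourhood of a vertex in the most
-- cliques, already known to be complete partite within `P`; what remains is to see that `P ∩ ∁ A`
-- is one more part.
module _ (G : Graph n) (P A : Subset n) (k : ℕ) (a : Fin (suc k) → ℕ)
  (K-free : cliques G (3 + k) P ≡ 0) (K-free-A : cliques G (2 + k) (P ∩ A) ≡ 0)
  (maximal : ∀ {x} → x ∈ P → cliques G (suc k) (P ∩ adj G x) ≤ cliques G (suc k) (P ∩ A))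
  (A≤prod : cliques G (suc k) (P ∩ A) ≤ prodF a)
  (positive : 0 < cliques G (suc k) (P ∩ A))
  (partite : CompletePartite G (P ∩ A) a)
  (extremal : count (P ∩ ∁ A) * prodF a ≤ cliques G (2 + k) P)
  where
  private
    module K = CompletePartite partite

    D : ℕ
    D = cliques G (suc k) (P ∩ A)

  -- Adding w to A before applying cliques-⊆∩ replaces the term of w in the
  -- bound by the number of cliques in A ∩ N(w), so that number is maximal too.
  outside-sees-all-cliques : {w : Fin n} → w ∈ P ∩ ∁ A → prodF a ≤ cliques G (suc k) (P ∩ A ∩ adj G w)
  outside-sees-all-cliques {w} w∈ = +-cancelʳ-≤ (b * prodF a) (prodF a) _ (begin
    suc b * prodF a
      ≡⟨ cong (_* prodF a) (trans (cong suc (count-cong (P ∩ ∁ A′) (P ∩ ∁ A - w)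
           (λ x∈ → ∈-remove (∩-mono (λ x → x) (remove-⊆ ∘ ∁A′⇒) x∈) (remove-≢ (∁A′⇒ (∩-⊆ʳ x∈))))
           (λ x∈ → ∈-∩ (∩-⊆ˡ (remove-⊆ x∈)) (∉⇒∈∁ λ x∈A′ → ∈∁⇒∉ x∈A′ (remove-mono ∩-⊆ʳ x∈)))))
         (≡-sym (count-remove (P ∩ ∁ A) w∈))) ⟩
    count (P ∩ ∁ A) * prodF a
      ≤⟨ extremal ⟩
    cliques G (2 + k) P
      ≤⟨ cliques-⊆∩ G (suc k) P A′ D (λ u∈ _ → maximal u∈) ⟩
    cliques G (2 + k) (P ∩ A′) + b * D
      ≡⟨ cong (_+ b * D) (cliques-remove G (suc k) (P ∩ A′) w∈P∩A′) ⟩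
    cliques G (2 + k) (P ∩ A′ - w) + cliques G (suc k) (P ∩ A′ ∩ adj G w) + b * D
      ≤⟨ +-mono-≤ (+-mono-≤ (≤-trans (cliques-mono G (2 + k) (λ x∈ → shrink (remove-⊆ x∈) (remove-≢ x∈)))
                                     (≤-reflexive K-free-A))
                            (cliques-mono G (suc k) {Q = P ∩ A ∩ adj G w} λ x∈ →
                               ∈-∩ (shrink (∩-⊆ˡ x∈) λ { refl → adj-irrefl G (∩-⊆ʳ x∈) }) (∩-⊆ʳ x∈)))
                  (*-monoʳ-≤ b A≤prod) ⟩
    cliques G (suc k) (P ∩ A ∩ adj G w) + b * prodF a ∎)
    where
    -- This is `A` with `w` added, written through complements so that the complement of `A′` is
    -- `∁ A` with `w` removed.
    A′ = ∁ (∁ A - w)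
    b = count (P ∩ ∁ A′)
    ∁A′⇒ : ∁ A′ ⊆ ∁ A - w
    ∁A′⇒ {x} x∈ with x ∈? (∁ A - w)
    ... | yes x∈′ = x∈′
    ... | no  x∉′ = contradiction (∉⇒∈∁ x∉′) (∈∁⇒∉ x∈)
    w∈P∩A′ : w ∈ P ∩ A′
    w∈P∩A′ = ∈-∩ (∩-⊆ˡ w∈) (∉⇒∈∁ λ w∈′ → remove-≢ w∈′ refl)
    shrink : ∀ {x} → x ∈ P ∩ A′ → x ≢ w → x ∈ P ∩ A
    shrink {x} x∈ x≢w with x ∈? A
    ... | yes x∈A = ∈-∩ (∩-⊆ˡ x∈) x∈A
    ... | no  x∉A = contradiction (∈-remove (∉⇒∈∁ x∉A) x≢w) (∈∁⇒∉ (∩-⊆ʳ x∈))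

  -- If `w` missed some `x`, the cliques in its neighbourhood would all avoid `x`. But `x` lies in a
  -- clique of `P ∩ A`, so fewer than `prodF a` would remain.
  outside-complete : {w : Fin n} → w ∈ P ∩ ∁ A → P ∩ A ⊆ adj G w
  outside-complete {w} w∈ {x} x∈ with x ∈? adj G w
  ... | yes x∈N = x∈N
  ... | no  x∉N = contradiction (outside-sees-all-cliques w∈) (<⇒≱ (begin-strict
    cliques G (suc k) (P ∩ A ∩ adj G w)
      ≤⟨ cliques-mono G (suc k) (λ y∈ → ∈-remove (∩-⊆ˡ y∈) λ { refl → x∉N (∩-⊆ʳ y∈) }) ⟩
    cliques G (suc k) (P ∩ A - x)
      <⟨ m<m+n _ (K.extends x∈) ⟩
    cliques G (suc k) (P ∩ A - x) + cliques G k (P ∩ A ∩ adj G x)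
      ≡⟨ cliques-remove G k (P ∩ A) x∈ ⟨
    cliques G (suc k) (P ∩ A)
      ≤⟨ A≤prod ⟩
    prodF a ∎))

  -- Two adjacent vertices outside `A`, both complete to `P ∩ A`, would extend a clique on `suc k`
  -- vertices there to one on `3 + k`.
  outside-independent : {w x : Fin n} → w ∈ P ∩ ∁ A → x ∈ P ∩ ∁ A → x ∉ adj G w
  outside-independent {w} {x} w∈ x∈ x∈N = <⇒≱ positive (begin
    cliques G (suc k) (P ∩ A)
      ≤⟨ cliques-mono G (suc k) (λ y∈ → ∈-∩ (∈-∩ (∩-⊆ˡ y∈) (outside-complete w∈ y∈)) (outside-complete x∈ y∈)) ⟩
    cliques G (suc k) (P ∩ adj G w ∩ adj G x)
      ≤⟨ cliques-extend G (suc k) (P ∩ adj G w) (∈-∩ (∩-⊆ˡ x∈) x∈N) ⟩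
    cliques G (2 + k) (P ∩ adj G w)
      ≤⟨ cliques-extend G (2 + k) P (∩-⊆ˡ w∈) ⟩
    cliques G (3 + k) P
      ≡⟨ K-free ⟩
    0 ∎)

  extend-partite : {v : Fin n} → v ∈ P → P ∩ A ⊆ adj G v →
    CompletePartite G P (count (P ∩ ∁ A) F.∷ a)
  extend-partite {v} v∈P A⊆Nv = record
    { colour  = c
    ; same    = same
    ; differ  = differ
    ; sizes   = sizes
    ; extends = λ x∈P → extends (∈-∩∁-cases x∈P)
    }
    where
    c : Fin n → Fin (2 + k)
    c x = if A x then suc (K.colour x) else zero
    inside : ∀ {x} → x ∈ P ∩ A → c x ≡ suc (K.colour x)
    inside x∈ rewrite holds (∩-⊆ʳ x∈) = refl
    outside : ∀ {x} → x ∈ P ∩ ∁ A → c x ≡ zero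
    outside x∈ rewrite ∉⇒false (∈∁⇒∉ (∩-⊆ʳ x∈)) = refl
    same : ∀ {x y} → x ∈ P → y ∈ P → c x ≡ c y → y ∉ adj G x
    same x∈P y∈P e with ∈-∩∁-cases {A = A} x∈P | ∈-∩∁-cases {A = A} y∈P
    ... | inj₁ x∈ | inj₁ y∈ = K.same x∈ y∈ (Finₚ.suc-injective (trans (≡-sym (inside x∈)) (trans e (inside y∈))))
    ... | inj₁ x∈ | inj₂ y∈ = contradiction (trans (≡-sym (inside x∈)) (trans e (outside y∈))) λ ()
    ... | inj₂ x∈ | inj₁ y∈ = contradiction (trans (≡-sym (inside y∈)) (trans (≡-sym e) (outside x∈))) λ ()
    ... | inj₂ x∈ | inj₂ y∈ = outside-independent x∈ y∈
    differ : ∀ {x y} → x ∈ P → y ∈ P → c x ≢ c y → y ∈ adj G x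
    differ x∈P y∈P e with ∈-∩∁-cases {A = A} x∈P | ∈-∩∁-cases {A = A} y∈P
    ... | inj₁ x∈ | inj₁ y∈ = K.differ x∈ y∈ λ e′ → e (trans (inside x∈) (trans (cong suc e′) (≡-sym (inside y∈))))
    ... | inj₁ x∈ | inj₂ y∈ = adj-sym G (outside-complete y∈ x∈)
    ... | inj₂ x∈ | inj₁ y∈ = outside-complete x∈ y∈
    ... | inj₂ x∈ | inj₂ y∈ = contradiction (trans (outside x∈) (≡-sym (outside y∈))) e
    sizes : ∀ j → count (P ∩ fibre c j) ≡ _
    sizes zero = count-cong (P ∩ fibre c zero) (P ∩ ∁ A)
      (λ x∈ → to (∈-∩∁-cases (∩-⊆ˡ x∈)) (fibre⇒≡ (∩-⊆ʳ x∈)))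
      (λ x∈ → ∈-∩ (∩-⊆ˡ x∈) (∈-fibre (outside x∈)))
      where
      to : ∀ {x} → x ∈ P ∩ A ⊎ x ∈ P ∩ ∁ A → c x ≡ zero → x ∈ P ∩ ∁ A
      to (inj₁ x∈) e = contradiction (trans (≡-sym (inside x∈)) e) λ ()
      to (inj₂ x∈) e = x∈
    sizes (suc j) = trans (count-cong (P ∩ fibre c (suc j)) (P ∩ A ∩ fibre K.colour j)
      (λ x∈ → to (∈-∩∁-cases (∩-⊆ˡ x∈)) (fibre⇒≡ (∩-⊆ʳ x∈)))
      (λ x∈ → ∈-∩ (∩-⊆ˡ (∩-⊆ˡ x∈)) (∈-fibre (trans (inside (∩-⊆ˡ x∈)) (cong suc (fibre⇒≡ (∩-⊆ʳ x∈)))))))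
      (K.sizes j)
      where
      to : ∀ {x} → x ∈ P ∩ A ⊎ x ∈ P ∩ ∁ A → c x ≡ suc j → x ∈ P ∩ A ∩ fibre K.colour j
      to (inj₁ x∈) e = ∈-∩ x∈ (∈-fibre (Finₚ.suc-injective (trans (≡-sym (inside x∈)) e)))
      to (inj₂ x∈) e = contradiction (trans (≡-sym (outside x∈)) e) λ ()
    extends : ∀ {x} → x ∈ P ∩ A ⊎ x ∈ P ∩ ∁ A → 0 < cliques G (suc k) (P ∩ adj G x)
    extends {x} (inj₂ x∈) = ≤-trans positive
      (cliques-mono G (suc k) λ y∈ → ∈-∩ (∩-⊆ˡ y∈) (outside-complete x∈ y∈))
    -- A clique through `x` inside `A` must grow by one vertex of the new part; `v` is complete to
    -- `P ∩ A` and serves for every `x`.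
    extends {x} (inj₁ x∈) = ≤-trans (K.extends x∈) (≤-trans
      (cliques-mono G k λ y∈ → ∈-∩ (∩-monoˡ ∩-⊆ˡ y∈) (A⊆Nv (∩-⊆ˡ y∈)))
      (cliques-extend G k (P ∩ adj G x) (∈-∩ v∈P (adj-sym G (A⊆Nv x∈)))))

-- Erdős's degree majorisation, applied to the neighbourhood of a vertex v lying in
-- the most cliques: every K_{k+1} meets P ∖ N(v), so P ∖ N(v) serves as a new part.
zykov : (G : Graph n) (k : ℕ) (P : Subset n) → cliques G (2 + k) P ≡ 0 →
  Σ[ a ∈ (Fin (suc k) → ℕ) ] sumF a ≡ count P × cliques G (suc k) P ≤ prodF a ×
    (prodF a ≤ cliques G (suc k) P → 0 < prodF a → CompletePartite G P a)
zykov G zero P K-free = (λ _ → count P) , +-identityʳ _ ,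
  ≤-reflexive (trans (cliques-one G P) (≡-sym (*-identityʳ _))) , λ _ _ → record
    { colour  = λ _ → zero
    ; same    = λ x∈P y∈P _ y∈N → <⇒≱ z<s (≤-trans (≤-trans
        (cliques-extend G 0 (P ∩ adj G _) (∈-∩ y∈P y∈N))
        (cliques-extend G 1 P x∈P)) (≤-reflexive K-free))
    ; differ  = λ _ _ e → contradiction refl e
    ; sizes   = λ { zero → count-cong (P ∩ fibre (λ _ → zero) zero) P ∩-⊆ˡ (λ x∈ → ∈-∩ x∈ (∈-fibre refl)) }
    ; extends = λ _ → z<s
    }
zykov G (suc k) P K-free with Finₚ.any? (_∈? P)
-- With `P` empty every size is `0`, so the product vanishes and the equality clause holds
-- vacuously.
... | no none = (λ _ → 0) ,
  trans (sumF-zero (2 + k)) (≡-sym (n≤0⇒n≡0 (≮⇒≥ λ 0<c → none (count>0⇒∈ P 0<c)))) ,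
  ≤-reflexive (cliques-∅ G (suc k) P λ x∈P → none (_ , x∈P)) , λ _ ()
... | yes (u , u∈P)
  with v , v∈P , maximal ← maximum P (λ x → cliques G (suc k) (P ∩ adj G x)) u∈P
  with K-free-A ← n≤0⇒n≡0 (≤-trans (cliques-extend G (2 + k) P v∈P) (≤-reflexive K-free))
  with a , sum-a , A≤prod , partite ← zykov G k (P ∩ adj G v) K-free-A =
  count (P ∩ ∁ A) F.∷ a , trans (cong (count (P ∩ ∁ A) +_) sum-a) (count-split P A) , bound , λ extremal 0<prod →
    -- Equality descends to the neighbourhood: the size of the new part is a common factor, and it
    -- is positive because the whole product is.
    let prod≤A = *-cancelˡ-≤ (count (P ∩ ∁ A)) {{>-nonZero (0<count 0<prod)}} (≤-trans extremal bound′)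
        positive = ≤-trans (0<prodA 0<prod) prod≤A
    in extend-partite G P A k a K-free K-free-A maximal A≤prod positive
         (partite prod≤A (0<prodA 0<prod)) extremal v∈P ∩-⊆ʳ
  where
  A = adj G v
  bound′ : cliques G (2 + k) P ≤ count (P ∩ ∁ A) * cliques G (suc k) (P ∩ A)
  bound′ = subst (λ c → cliques G (2 + k) P ≤ c + count (P ∩ ∁ A) * cliques G (suc k) (P ∩ A)) K-free-A
    (cliques-⊆∩ G (suc k) P A (cliques G (suc k) (P ∩ A)) λ u∈ _ → maximal u∈)
  bound : cliques G (2 + k) P ≤ count (P ∩ ∁ A) * prodF a
  bound = ≤-trans bound′ (*-monoʳ-≤ (count (P ∩ ∁ A)) A≤prod)
  0<count : 0 < count (P ∩ ∁ A) * prodF a → 0 < count (P ∩ ∁ A)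
  0<count 0<p = n≢0⇒n>0 λ e → <⇒≢ 0<p (≡-sym (cong (_* prodF a) e))
  0<prodA : 0 < count (P ∩ ∁ A) * prodF a → 0 < prodF a
  0<prodA 0<p = n≢0⇒n>0 λ e → <⇒≢ 0<p (≡-sym (trans (cong (count (P ∩ ∁ A) *_) e) (*-zeroʳ (count (P ∩ ∁ A)))))

-- Products of balanced families

prodF-cong : {x y : Fin k → ℕ} → (∀ i → x i ≡ y i) → prodF x ≡ prodF y
prodF-cong {zero}  x≡y = refl
prodF-cong {suc k} x≡y = cong₂ _*_ (x≡y zero) (prodF-cong (x≡y ∘ suc))

prodF-mono : {x y : Fin k → ℕ} → (∀ i → x i ≤ y i) → prodF x ≤ prodF y
prodF-mono {zero}  x≤y = ≤-refl
prodF-mono {suc k} x≤y = *-mono-≤ (x≤y zero) (prodF-mono (x≤y ∘ suc))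

prodF-const : ∀ k q → prodF {k} (λ _ → q) ≡ q ^ k
prodF-const zero    q = refl
prodF-const (suc k) q = cong (q *_) (prodF-const k q)

prodF-positive : {x : Fin k → ℕ} → (∀ i → 0 < x i) → 0 < prodF x
prodF-positive {zero}  0<x = z<s
prodF-positive {suc k} 0<x = *-mono-≤ (0<x zero) (prodF-positive (0<x ∘ suc))

prodF-strict : {x y : Fin k → ℕ} → (∀ i → x i ≤ y i) → (∀ i → 0 < y i) →
  ∀ i → x i < y i → prodF x < prodF y
prodF-strict {suc k} {x} {y} x≤y 0<y zero xᵢ<yᵢ = begin-strict
  x zero * prodF (x ∘ suc) ≤⟨ *-monoʳ-≤ (x zero) (prodF-mono (x≤y ∘ suc)) ⟩
  x zero * prodF (y ∘ suc) <⟨ *-monoˡ-< _ {{>-nonZero (prodF-positive (0<y ∘ suc))}} xᵢ<yᵢ ⟩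
  y zero * prodF (y ∘ suc) ∎
prodF-strict {suc k} {x} {y} x≤y 0<y (suc i) xᵢ<yᵢ = begin-strict
  x zero * prodF (x ∘ suc) ≤⟨ *-monoˡ-≤ (prodF (x ∘ suc)) (x≤y zero) ⟩
  y zero * prodF (x ∘ suc) <⟨ *-monoʳ-< (y zero) {{>-nonZero (0<y zero)}} (prodF-strict (x≤y ∘ suc) (0<y ∘ suc) i xᵢ<yᵢ) ⟩
  y zero * prodF (y ∘ suc) ∎

module Balanced (q : ℕ) {{_ : NonZero q}} where

  Near : ℕ → Set
  Near a = a ≡ q ⊎ a ≡ suc q

  -- a ↦ q ((q+1)/q)^(a-q) is the exponential through (q, q) and (q+1, q+1); it
  -- dominates the identity on ℕ. Cleared of denominators this reads chord a ≤ curve a.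
  chord curve : ℕ → ℕ
  chord a = a * (q ^ a * suc q ^ q)
  curve a = q * q ^ q * suc q ^ a

  chord-suc : ∀ a → chord (suc a) ≡ suc a * q * (q ^ a * suc q ^ q)
  chord-suc a = shuffle (suc a) q (q ^ a) (suc q ^ q)
    where
    shuffle : ∀ a q x y → a * (q * x * y) ≡ a * q * (x * y)
    shuffle = solve-∀

  curve-suc : ∀ a → curve (suc a) ≡ suc q * curve a
  curve-suc a = shuffle (suc q) (q * q ^ q) (suc q ^ a)
    where
    shuffle : ∀ s x y → x * (s * y) ≡ s * (x * y)
    shuffle = solve-∀

  scale-positive : ∀ a → 0 < q ^ a * suc q ^ q
  scale-positive a = *-mono-≤ (m^n>0 q a) (m^n>0 (suc q) q)

  curve-positive : ∀ a → 0 < curve a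
  curve-positive a = *-mono-≤ (*-mono-≤ (>-nonZero⁻¹ q) (m^n>0 q q)) (m^n>0 (suc q) a)

  Near⇒chord≡curve : ∀ {a} → Near a → chord a ≡ curve a
  Near⇒chord≡curve (inj₁ refl) = ≡-sym (*-assoc q (q ^ q) (suc q ^ q))
  Near⇒chord≡curve (inj₂ refl) = begin-equality
    chord (suc q)                   ≡⟨ chord-suc q ⟩
    suc q * q * (q ^ q * suc q ^ q) ≡⟨ *-assoc (suc q) q _ ⟩
    suc q * chord q                 ≡⟨ cong (suc q *_) (Near⇒chord≡curve (inj₁ refl)) ⟩
    suc q * curve q                 ≡⟨ curve-suc q ⟨
    curve (suc q) ∎

  -- Passing from `a` to `suc a` multiplies `curve` by `suc q` and `chord` by `suc a * q` over `a`.
  -- The first factor is the larger one once `q < a`, so a gap opens above the point of equality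
  -- `suc q`.
  chord-above : ∀ d → chord (2 + d + q) < curve (2 + d + q)
  chord-above d = begin-strict
    chord (suc a)                   ≡⟨ chord-suc a ⟩
    suc a * q * (q ^ a * suc q ^ q)
      <⟨ *-monoˡ-< _ {{>-nonZero (scale-positive a)}} (+-mono-<-≤ (s≤s (m≤n+m q d)) (≤-reflexive (*-comm a q))) ⟩
    suc q * a * (q ^ a * suc q ^ q) ≡⟨ *-assoc (suc q) a _ ⟩
    suc q * chord a                 ≤⟨ *-monoʳ-≤ (suc q) (below d) ⟩
    suc q * curve a                 ≡⟨ curve-suc a ⟨
    curve (suc a) ∎
    where
    a = suc d + q
    below : ∀ d → chord (suc d + q) ≤ curve (suc d + q)
    below zero    = ≤-reflexive (Near⇒chord≡curve (inj₂ refl))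
    below (suc d) = <⇒≤ (chord-above d)

  -- The same ratios read downwards: for `a < q` the step to `suc a` favours `chord`, so `chord`
  -- must have been strictly behind at `a`. Multiplying through by `suc q` avoids dividing by `a`,
  -- which may be `0`.
  chord-below : ∀ e a → suc e + a ≡ q → chord a < curve a
  chord-below e a e+a≡q = *-cancelˡ-< (suc q) _ _ (begin-strict
    suc q * chord a                 ≡⟨ *-assoc (suc q) a _ ⟨
    suc q * a * (q ^ a * suc q ^ q)
      <⟨ *-monoˡ-< _ {{>-nonZero (scale-positive a)}} less ⟩
    suc a * q * (q ^ a * suc q ^ q) ≡⟨ chord-suc a ⟨
    chord (suc a)                   ≤⟨ above e e+a≡q ⟩
    curve (suc a)                   ≡⟨ curve-suc a ⟩
    suc q * curve a ∎)
    where
    less : suc q * a < suc a * q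
    less = +-mono-<-≤ (subst (a <_) e+a≡q (s≤s (m≤n+m a e))) (≤-reflexive (*-comm q a))
    above : ∀ e → suc e + a ≡ q → chord (suc a) ≤ curve (suc a)
    above zero    refl = ≤-reflexive (Near⇒chord≡curve (inj₁ refl))
    above (suc e) eq   = <⇒≤ (chord-below e (suc a) (trans (cong suc (+-suc e a)) eq))

  chord-vs-curve : ∀ a → Near a ⊎ chord a < curve a
  chord-vs-curve a with a <? q
  ... | yes a<q = inj₂ (chord-below (q ∸ suc a) a (trans (≡-sym (+-suc (q ∸ suc a) a)) (m∸n+n≡m a<q)))
  ... | no  a≮q = subst (λ a → Near a ⊎ chord a < curve a) (m∸n+n≡m (≮⇒≥ a≮q)) (from (a ∸ q))
    where
    from : ∀ d → Near (d + q) ⊎ chord (d + q) < curve (d + q)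
    from zero          = inj₁ (inj₁ refl)
    from (suc zero)    = inj₁ (inj₂ refl)
    from (suc (suc d)) = inj₂ (chord-above d)

  chord≤curve : ∀ a → chord a ≤ curve a
  chord≤curve a with chord-vs-curve a
  ... | inj₁ near   = ≤-reflexive (Near⇒chord≡curve near)
  ... | inj₂ a<c    = <⇒≤ a<c

  prodF-chord : (a : Fin k → ℕ) → prodF (chord ∘ a) ≡ prodF a * (q ^ sumF a * (suc q ^ q) ^ k)
  prodF-chord {zero}  a = refl
  prodF-chord {suc k} a = begin-equality
    chord (a zero) * prodF (chord ∘ a ∘ suc)
      ≡⟨ cong (chord (a zero) *_) (prodF-chord (a ∘ suc)) ⟩
    chord (a zero) * (prodF (a ∘ suc) * (q ^ sumF (a ∘ suc) * (suc q ^ q) ^ k))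
      ≡⟨ shuffle (a zero) (q ^ a zero) (suc q ^ q) (prodF (a ∘ suc)) (q ^ sumF (a ∘ suc)) _ ⟩
    prodF a * (q ^ a zero * q ^ sumF (a ∘ suc) * (suc q ^ q) ^ suc k)
      ≡⟨ cong (λ x → prodF a * (x * (suc q ^ q) ^ suc k)) (^-distribˡ-+-* q (a zero) _) ⟨
    prodF a * (q ^ sumF a * (suc q ^ q) ^ suc k) ∎
    where
    shuffle : ∀ x y z p r t → x * (y * z) * (p * (r * t)) ≡ x * p * (y * r * (z * t))
    shuffle = solve-∀

  -- An exponential turns a product into a function of the sum. The scale factors in `prodF-chord`
  -- also depend on the sum alone, so families with equal sums can be compared factor by factor.
  prodF-curve : (a : Fin k → ℕ) → prodF (curve ∘ a) ≡ (q * q ^ q) ^ k * suc q ^ sumF a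
  prodF-curve {zero}  a = refl
  prodF-curve {suc k} a = begin-equality
    curve (a zero) * prodF (curve ∘ a ∘ suc)
      ≡⟨ cong (curve (a zero) *_) (prodF-curve (a ∘ suc)) ⟩
    curve (a zero) * ((q * q ^ q) ^ k * suc q ^ sumF (a ∘ suc))
      ≡⟨ shuffle (q * q ^ q) (suc q ^ a zero) ((q * q ^ q) ^ k) (suc q ^ sumF (a ∘ suc)) ⟩
    (q * q ^ q) ^ suc k * (suc q ^ a zero * suc q ^ sumF (a ∘ suc))
      ≡⟨ cong ((q * q ^ q) ^ suc k *_) (^-distribˡ-+-* (suc q) (a zero) _) ⟨
    (q * q ^ q) ^ suc k * suc q ^ sumF a ∎
    where
    shuffle : ∀ x y z w → x * y * (z * w) ≡ x * z * (y * w)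
    shuffle = solve-∀

  module _ (a b : Fin k → ℕ) (same-sum : sumF a ≡ sumF b) (b-near : ∀ i → Near (b i)) where
    private
      M = q ^ sumF b * (suc q ^ q) ^ k

      instance
        M-nonZero : NonZero M
        M-nonZero = >-nonZero (*-mono-≤ (m^n>0 q (sumF b)) (m^n>0 (suc q ^ q) {{m^n≢0 (suc q) q}} k))

      chord-a : prodF a * M ≡ prodF (chord ∘ a)
      chord-a = trans (cong (λ s → prodF a * (q ^ s * (suc q ^ q) ^ k)) (≡-sym same-sum)) (≡-sym (prodF-chord a))

      -- Only the sum enters the product of curves, so `a` may be replaced by `b`; on `b` the curve
      -- and the chord agree.
      curve-a : prodF (curve ∘ a) ≡ prodF b * M
      curve-a = begin-equality
        prodF (curve ∘ a)                ≡⟨ prodF-curve a ⟩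
        (q * q ^ q) ^ k * suc q ^ sumF a ≡⟨ cong (λ s → (q * q ^ q) ^ k * suc q ^ s) same-sum ⟩
        (q * q ^ q) ^ k * suc q ^ sumF b ≡⟨ prodF-curve b ⟨
        prodF (curve ∘ b)                ≡⟨ prodF-cong (λ i → Near⇒chord≡curve (b-near i)) ⟨
        prodF (chord ∘ b)                ≡⟨ prodF-chord b ⟩
        prodF b * M ∎

    prodF≤balanced : prodF a ≤ prodF b
    prodF≤balanced = *-cancelʳ-≤ (prodF a) (prodF b) M (begin
      prodF a * M       ≡⟨ chord-a ⟩
      prodF (chord ∘ a) ≤⟨ prodF-mono (chord≤curve ∘ a) ⟩
      prodF (curve ∘ a) ≡⟨ curve-a ⟩
      prodF b * M ∎)

    -- All values of `curve` are positive, so a strict inequality at one part survives in the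
    -- product.
    extremal⇒Near : prodF b ≤ prodF a → ∀ i → Near (a i)
    extremal⇒Near b≤a i with chord-vs-curve (a i)
    ... | inj₁ near = near
    ... | inj₂ a<c  = contradiction b≤a (<⇒≱ (*-cancelʳ-< M (prodF a) (prodF b) (begin-strict
      prodF a * M       ≡⟨ chord-a ⟩
      prodF (chord ∘ a) <⟨ prodF-strict (chord≤curve ∘ a) (curve-positive ∘ a) i a<c ⟩
      prodF (curve ∘ a) ≡⟨ curve-a ⟩
      prodF b * M ∎)))

-- Turán graphs

rank : Subset n → Fin n → ℕ
rank P zero    = 0
rank P (suc x) = (if P zero then 1 else 0) + rank (tail P) x

rank<count : (P : Subset n) {x : Fin n} → x ∈ P → rank P x < count P
rank<count P {zero}  0∈P = subst (0 <_) (≡-sym (count-zero∈ P 0∈P)) z<s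
rank<count P {suc x} x∈P = +-monoʳ-< (if P zero then 1 else 0) (rank<count (tail P) (tail⁺ x∈P))

rank-injective : (P : Subset n) {x y : Fin n} → x ∈ P → y ∈ P → rank P x ≡ rank P y → x ≡ y
rank-injective P {zero}  {zero}  _    _    _ = refl
rank-injective P {zero}  {suc y} 0∈P _    e rewrite holds 0∈P = contradiction e 0≢1+n
rank-injective P {suc x} {zero}  _    0∈P e rewrite holds 0∈P = contradiction e 1+n≢0
rank-injective P {suc x} {suc y} x∈P y∈P e =
  cong suc (rank-injective (tail P) (tail⁺ x∈P) (tail⁺ y∈P) (+-cancelˡ-≡ (if P zero then 1 else 0) _ _ e))

injection≤count : ∀ {b} (C : Subset n) (f : Fin b → Fin n) → (∀ {i j} → f i ≡ f j → i ≡ j) → (∀ i → f i ∈ C) →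
  b ≤ count C
injection≤count {b = zero}  C f inj f∈C = z≤n
injection≤count {b = suc b} C f inj f∈C = subst (suc b ≤_) (≡-sym (count-remove C (f∈C zero)))
  (s≤s (injection≤count (C - f zero) (f ∘ suc) (Finₚ.suc-injective ∘ inj)
    λ i → ∈-remove (f∈C (suc i)) λ e → Finₚ.0≢1+n (≡-sym (inj e))))

does⇒ : {A : Set} (d : Dec A) → does d ≡ true → A
does⇒ (yes a) _ = a

below : ℕ → Subset k
below s j = does (toℕ j <? s)

∈below⇒< : ∀ {s} {j : Fin k} → j ∈ below s → toℕ j < s
∈below⇒< {s = s} {j} (mem e) = does⇒ (toℕ j <? s) e

<⇒∈below : ∀ {s} {j : Fin k} → toℕ j < s → j ∈ below s
<⇒∈below {s = s} {j} j<s = mem (dec-true (toℕ j <? s) j<s)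

count-below : ∀ {s} → s ≤ k → count {k} (below s) ≡ s
count-below {zero}  z≤n = refl
count-below {suc k} {zero} _ = n≤0⇒n≡0 (≮⇒≥ λ 0<c → n≮0 (∈below⇒< (proj₂ (count>0⇒∈ (below {suc k} 0) 0<c))))
count-below {suc k} {suc s} (s≤s s≤k) = trans (count-zero∈ {k} (below (suc s)) (mem refl))
  (cong suc (trans (count-cong {k} (tail (below (suc s))) (below s)
                      (λ j∈ → <⇒∈below (s≤s⁻¹ (∈below⇒< (tail⁻ j∈))))
                      (λ j∈ → tail⁺ (<⇒∈below (s≤s (∈below⇒< j∈)))))
                   (count-below s≤k)))

sumF-two-valued : ∀ q (S : Subset k) (a : Fin k → ℕ) → (∀ {j} → j ∈ S → a j ≡ suc q) → (∀ {j} → j ∉ S → a j ≡ q) →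
  sumF a ≡ count S + k * q
sumF-two-valued {zero}  q S a high low = refl
sumF-two-valued {suc k} q S a high low
  with sumF-two-valued q (tail S) (a ∘ suc) (high ∘ tail⁻) (λ j∉ → low (j∉ ∘ tail⁺)) | zero ∈? S
... | ih | yes 0∈S = begin-equality
  a zero + sumF (a ∘ suc)         ≡⟨ cong₂ _+_ (high 0∈S) ih ⟩
  suc q + (count (tail S) + k * q) ≡⟨ shuffle q (count (tail S)) (k * q) ⟩
  suc (count (tail S)) + suc k * q ≡⟨ cong (_+ suc k * q) (count-zero∈ S 0∈S) ⟨
  count S + suc k * q ∎
  where
  shuffle : ∀ q c x → suc q + (c + x) ≡ suc c + (q + x)
  shuffle q c x = cong suc (trans (≡-sym (+-assoc q c x)) (trans (cong (_+ x) (+-comm q c)) (+-assoc c q x)))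
... | ih | no 0∉S = begin-equality
  a zero + sumF (a ∘ suc)     ≡⟨ cong₂ _+_ (low 0∉S) ih ⟩
  q + (count (tail S) + k * q) ≡⟨ shuffle q (count (tail S)) (k * q) ⟩
  count (tail S) + suc k * q   ≡⟨ cong (_+ suc k * q) (count-zero∉ S 0∉S) ⟨
  count S + suc k * q ∎
  where
  shuffle : ∀ q c x → q + (c + x) ≡ c + (q + x)
  shuffle q c x = trans (≡-sym (+-assoc q c x)) (trans (cong (_+ x) (+-comm q c)) (+-assoc c q x))

-- In `turan` the larger parts are those of the smallest residues, whereas the colours of an
-- extremal graph come in no particular order. `place` renames the colours so that those in `S`, the
-- larger parts, come first.
record Sorting (S : Subset k) : Set where
  field
    place           : Fin k → ℕ
    place<          : ∀ j → place j < k
    place-injective : ∀ {i j} → place i ≡ place j → i ≡ j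
    place-∈         : ∀ {j} → j ∈ S → place j < count S

sorting : (S : Subset k) → Sorting S
sorting {k} S = record
  { place = λ j → σ j (j ∈? S)
  ; place< = λ j → σ< (j ∈? S)
  ; place-injective = λ {i} {j} → σ-injective (i ∈? S) (j ∈? S)
  ; place-∈ = λ {j} j∈S → σ-∈ j∈S (j ∈? S)
  }
  where
  R = ⊤ ∩ ∁ S
  total : count S + count R ≡ k
  total = trans (+-comm (count S) (count R)) (trans
    (cong (count R +_) (count-cong S (⊤ ∩ S) (∈-∩ ∈⊤) ∩-⊆ʳ)) (trans (count-split ⊤ S) (count-⊤ k)))
  ∉⇒∈R : ∀ {j} → j ∉ S → j ∈ R
  ∉⇒∈R j∉S = ∈-∩ ∈⊤ (∉⇒∈∁ j∉S)
  σ : (j : Fin k) → Dec (j ∈ S) → ℕ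
  σ j (yes _) = rank S j
  σ j (no  _) = count S + rank R j
  σ-∈ : ∀ {j} → j ∈ S → (d : Dec (j ∈ S)) → σ j d < count S
  σ-∈ j∈S (yes _)   = rank<count S j∈S
  σ-∈ j∈S (no  j∉S) = contradiction j∈S j∉S
  σ< : ∀ {j} (d : Dec (j ∈ S)) → σ j d < k
  σ< (yes j∈S) = <-≤-trans (rank<count S j∈S) (m+n≤o⇒m≤o (count S) (≤-reflexive total))
  σ< (no  j∉S) = <-≤-trans (+-monoʳ-< (count S) (rank<count R (∉⇒∈R j∉S))) (≤-reflexive total)
  σ-injective : ∀ {i j} (d : Dec (i ∈ S)) (e : Dec (j ∈ S)) → σ i d ≡ σ j e → i ≡ j
  σ-injective (yes i∈S) (yes j∈S) eq = rank-injective S i∈S j∈S eq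
  σ-injective (no  i∉S) (no  j∉S) eq = rank-injective R (∉⇒∈R i∉S) (∉⇒∈R j∉S) (+-cancelˡ-≡ (count S) _ _ eq)
  σ-injective (yes i∈S) (no  _)   eq = contradiction (rank<count S i∈S) (≤⇒≯ (m+n≤o⇒m≤o (count S) (≤-reflexive (≡-sym eq))))
  σ-injective (no  _)   (yes j∈S) eq = contradiction (rank<count S j∈S) (≤⇒≯ (m+n≤o⇒m≤o (count S) (≤-reflexive eq)))

-- The numbers below `s + q * k` fill a table with `k` columns: `q` full rows, then a last row
-- reaching only the columns below `s`. Row `i` is a rank within a part, column `t` the part.
position< : ∀ {q s k i t} → t < k → i < q ⊎ (i ≡ q × t < s) → i * k + t < s + q * k
position< {q} {s} {k} {i} {t} t<k (inj₁ i<q) = begin-strict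
  i * k + t  <⟨ +-monoʳ-< (i * k) t<k ⟩
  i * k + k  ≡⟨ +-comm (i * k) k ⟩
  suc i * k  ≤⟨ *-monoˡ-≤ k i<q ⟩
  q * k      ≤⟨ m≤n+m (q * k) s ⟩
  s + q * k ∎
position< {q} {s} {k} {i} {t} t<k (inj₂ (refl , t<s)) = begin-strict
  i * k + t  <⟨ +-monoʳ-< (i * k) t<s ⟩
  i * k + s  ≡⟨ +-comm (i * k) s ⟩
  s + i * k ∎

position-% : ∀ i {t k} → t < suc k → (i * suc k + t) % suc k ≡ t
position-% i {t} {k} t<k = trans (cong (_% suc k) (+-comm (i * suc k) t))
  (trans ([m+kn]%n≡m%n t i (suc k)) (m<n⇒m%n≡m t<k))

<-split : ∀ {i a} → i < suc a → i < a ⊎ i ≡ a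
<-split {i} {a} i<1+a = m≤n⇒m<n∨m≡n (s≤s⁻¹ i<1+a)

opaque
  ⋃ : (Fin k → Subset n) → Subset n
  ⋃ U x = does (Finₚ.any? λ j → x ∈? U j)

  ∈⋃⇒ : {U : Fin k → Subset n} {x : Fin n} → x ∈ ⋃ U → ∃[ j ] x ∈ U j
  ∈⋃⇒ {U = U} {x} (mem e) = does⇒ (Finₚ.any? λ j → x ∈? U j) e

  ∈⋃ : {U : Fin k → Subset n} {x : Fin n} (j : Fin k) → x ∈ U j → x ∈ ⋃ U
  ∈⋃ {U = U} {x} j x∈ = mem (dec-true (Finₚ.any? λ j → x ∈? U j) (j , x∈))

prodF≤cliques : (G : Graph n) (U : Fin k → Subset n) →
  (∀ {i j x y} → i ≢ j → x ∈ U i → y ∈ U j → y ∈ adj G x) → prodF (count ∘ U) ≤ cliques G k (⋃ U)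
prodF≤cliques {k = zero}  G U complete = ≤-refl
prodF≤cliques {k = suc k} G U complete = ≤-trans
  (*-monoʳ-≤ (count (U zero)) (prodF≤cliques G (U ∘ suc) (λ i≢j → complete (i≢j ∘ Finₚ.suc-injective))))
  (complete-≤-cliques G k (⋃ U) (⋃ (U ∘ suc)) (U zero)
    (λ x∈ → let j , x∈U = ∈⋃⇒ x∈ in ∈⋃ (suc j) x∈U)
    (∈⋃ zero)
    (λ u∈ y∈ → let j , y∈U = ∈⋃⇒ y∈ in complete (λ ()) u∈ y∈U))

residue : (k : ℕ) → Fin n → Fin (suc k)
residue k i = toℕ i mod suc k

toℕ-residue : (k : ℕ) (i : Fin n) → toℕ (residue k i) ≡ toℕ i % suc k
toℕ-residue k i = Finₚ.toℕ-fromℕ< (m%n<n (toℕ i) (suc k))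

turan-same : (k : ℕ) (x y : Fin n) → residue k x ≡ residue k y → y ∉ adj (turan (suc k) n) x
turan-same k x y e = false⇒∉ (cong not (trans (cong (eqℕ (toℕ x % suc k)) y≡x) (eqℕ-refl (toℕ x % suc k))))
  where
  y≡x : toℕ y % suc k ≡ toℕ x % suc k
  y≡x = trans (≡-sym (toℕ-residue k y)) (trans (cong toℕ (≡-sym e)) (toℕ-residue k x))

turan-differ : (k : ℕ) (x y : Fin n) → residue k x ≢ residue k y → y ∈ adj (turan (suc k) n) x
turan-differ k x y e = mem (cong not (¬-not λ eq → e (Finₚ.toℕ-injective
  (trans (toℕ-residue k x) (trans (eqℕ⇒≡ _ _ eq) (≡-sym (toℕ-residue k y)))))))

turan-CliqueIn-absurd : (k m : ℕ) {P : Subset m} → ¬ CliqueIn (turan (suc k) m) (2 + k) P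
turan-CliqueIn-absurd k m K with i , j , i<j , e ← Finₚ.pigeonhole ≤-refl (residue k ∘ CliqueIn.vertex K) =
  turan-same k (CliqueIn.vertex K i) (CliqueIn.vertex K j) e (CliqueIn.adjacent K (Finₚ.<⇒≢ i<j))

turan-K-free : (k m : ℕ) (P : Subset m) → cliques (turan (suc k) m) (2 + k) P ≡ 0
turan-K-free k m P = n≤0⇒n≡0 (≮⇒≥ (turan-CliqueIn-absurd k m ∘ cliques>0⇒CliqueIn (turan (suc k) m) (2 + k) P))

turan-sizes : ℕ → ℕ → Fin k → ℕ
turan-sizes q s j = if below s j then suc q else q

turan-sizes-∈ : ∀ q s {j : Fin k} → j ∈ below s → turan-sizes q s j ≡ suc q
turan-sizes-∈ q s (mem e) rewrite e = refl

turan-sizes-∉ : ∀ q s {j : Fin k} → j ∉ below s → turan-sizes q s j ≡ q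
turan-sizes-∉ q s j∉ rewrite ∉⇒false j∉ = refl

-- A lower bound on the part sizes suffices, since the clique count of the Turán graph only has to
-- dominate the balanced product. The vertices `i * suc k + j` witness it.
turan-sizes≤count : ∀ k m (j : Fin (suc k)) → turan-sizes (m / suc k) (m % suc k) j ≤ count (fibre (residue {m} k) j)
turan-sizes≤count k m j = injection≤count (fibre (residue k) j) f f-injective λ i → ∈-fibre (residue-f i)
  where
  q = m / suc k
  s = m % suc k
  b = turan-sizes q s j
  fits : ∀ {i} → i < b → i < q ⊎ (i ≡ q × toℕ j < s)
  fits {i} i<b with j ∈? below s
  ... | no j∉ = inj₁ (subst (i <_) (turan-sizes-∉ q s j∉) i<b)
  ... | yes j∈ with <-split (subst (i <_) (turan-sizes-∈ q s j∈) i<b)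
  ... | inj₁ i<q = inj₁ i<q
  ... | inj₂ i≡q = inj₂ (i≡q , ∈below⇒< j∈)
  position<m : (i : Fin b) → toℕ i * suc k + toℕ j < m
  position<m i = subst (toℕ i * suc k + toℕ j <_) (≡-sym (m≡m%n+[m/n]*n m (suc k)))
    (position< {q} (Finₚ.toℕ<n j) (fits (Finₚ.toℕ<n i)))
  f : Fin b → Fin m
  f i = fromℕ< (position<m i)
  toℕ-f : ∀ i → toℕ (f i) ≡ toℕ i * suc k + toℕ j
  toℕ-f i = Finₚ.toℕ-fromℕ< (position<m i)
  f-injective : ∀ {i i′} → f i ≡ f i′ → i ≡ i′
  f-injective {i} {i′} e = Finₚ.toℕ-injective (*-cancelʳ-≡ (toℕ i) (toℕ i′) (suc k)
    (+-cancelʳ-≡ (toℕ j) _ _ (trans (≡-sym (toℕ-f i)) (trans (cong toℕ e) (toℕ-f i′)))))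
  residue-f : ∀ i → residue k (f i) ≡ j
  residue-f i = Finₚ.toℕ-injective (trans (toℕ-residue k (f i))
    (trans (cong (_% suc k) (toℕ-f i)) (position-% (toℕ i) (Finₚ.toℕ<n j))))

prodF-turan-sizes≤cliques : ∀ k m → prodF {suc k} (turan-sizes (m / suc k) (m % suc k)) ≤ cliques (turan (suc k) m) (suc k) ⊤
prodF-turan-sizes≤cliques k m = ≤-trans (prodF-mono (turan-sizes≤count k m)) (≤-trans
  (prodF≤cliques (turan (suc k) m) (fibre (residue k)) λ {i} {j} {x} {y} i≢j x∈ y∈ → turan-differ k x y λ e →
    i≢j (trans (≡-sym (fibre⇒≡ x∈)) (trans e (fibre⇒≡ y∈))))
  (cliques-mono (turan (suc k) m) (suc k) (λ _ → ∈⊤)))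

sumF-turan-sizes : ∀ k m → sumF {suc k} (turan-sizes (m / suc k) (m % suc k)) ≡ m
sumF-turan-sizes k m = trans
  (sumF-two-valued {suc k} (m / suc k) (below (m % suc k)) (turan-sizes (m / suc k) (m % suc k)) (turan-sizes-∈ _ (m % suc k)) (turan-sizes-∉ _ (m % suc k)))
  (trans (cong₂ _+_ (count-below (<⇒≤ (m%n<n m (suc k)))) (*-comm (suc k) (m / suc k))) (≡-sym (m≡m%n+[m/n]*n m (suc k))))

-- Recognising the cone over a Turán graph

adj-≡ : (G : Graph n) (x y : Fin n) (H : Graph k) (x′ y′ : Fin k) →
  (y ∈ adj G x → y′ ∈ adj H x′) → (y′ ∈ adj H x′ → y ∈ adj G x) → adj G x y ≡ adj H x′ y′
adj-≡ _ _ _ _ _ _ to from = ⇔→≡ (mk⇔ (holds ∘ to ∘ mem) (holds ∘ from ∘ mem))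

injective⇒surjective : (f : Fin n → Fin n) → (∀ {x y} → f x ≡ f y → x ≡ y) → ∀ y → ∃[ x ] f x ≡ y
injective⇒surjective {suc n} f inj y with Finₚ.any? (λ x → f x Finₚ.≟ y)
... | yes found = found
... | no missed = contradiction
  (Finₚ.injective⇒≤ {f = λ x → punchOut (missed′ x)} (inj ∘ Finₚ.punchOut-injective (missed′ _) (missed′ _))) 1+n≰n
  where
  missed′ : ∀ x → y ≢ f x
  missed′ x e = missed (x , ≡-sym e)

module _ (k m q : ℕ) (G : Graph (suc m)) (v : Fin (suc m)) {a : Fin (suc k) → ℕ}
  (partite : CompletePartite G (⊤ - v) a) (universal : ⊤ - v ⊆ adj G v)
  (near : ∀ j → a j ≡ q ⊎ a j ≡ suc q) (sum-a : sumF a ≡ m)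
  where
  private
    module K = CompletePartite partite
    P = ⊤ - v

    high : Subset (suc k)
    high j = does (a j ≟ suc q)

    high⇒ : ∀ {j} → j ∈ high → a j ≡ suc q
    high⇒ {j} (mem e) = does⇒ (a j ≟ suc q) e

    low⇒ : ∀ {j} → j ∉ high → a j ≡ q
    low⇒ {j} j∉ with near j
    ... | inj₁ e = e
    ... | inj₂ e = contradiction (mem (dec-true (a j ≟ suc q) e)) j∉

    open Sorting (sorting high)

    total : count high + q * suc k ≡ m
    total = trans (cong (count high +_) (*-comm q (suc k)))
      (trans (≡-sym (sumF-two-valued q high a high⇒ low⇒)) sum-a)

    class : Fin (suc m) → Subset (suc m)
    class x = P ∩ fibre K.colour (K.colour x)

    ∈class : ∀ {x} → x ∈ P → x ∈ class x
    ∈class x∈P = ∈-∩ x∈P (∈-fibre refl)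

    -- The vertex of rank `i` in its part goes to the `i`-th vertex of the residue class assigned to
    -- that part, so that the remainder recovers the colour and cancelling it leaves the rank.
    position : Fin (suc m) → ℕ
    position x = rank (class x) x * suc k + place (K.colour x)

    position<m : ∀ {x} → x ∈ P → position x < m
    position<m {x} x∈P = subst (position x <_) total (position< (place< (K.colour x)) (fits (K.colour x ∈? high)))
      where
      r<a : rank (class x) x < a (K.colour x)
      r<a = subst (rank (class x) x <_) (K.sizes (K.colour x)) (rank<count (class x) (∈class x∈P))
      fits : Dec (K.colour x ∈ high) →
        rank (class x) x < q ⊎ (rank (class x) x ≡ q × place (K.colour x) < count high)
      fits (no  j∉) = inj₁ (subst (rank (class x) x <_) (low⇒ j∉) r<a)
      fits (yes j∈) with <-split (subst (rank (class x) x <_) (high⇒ j∈) r<a)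
      ... | inj₁ r<q = inj₁ r<q
      ... | inj₂ r≡q = inj₂ (r≡q , place-∈ j∈)

    position-%k : ∀ x → position x % suc k ≡ place (K.colour x)
    position-%k x = position-% (rank (class x) x) (place< (K.colour x))

    position-injective : ∀ {x y} → x ∈ P → y ∈ P → position x ≡ position y → x ≡ y
    position-injective {x} {y} x∈P y∈P e = rank-injective (class x) (∈class x∈P)
      (subst (λ j → y ∈ P ∩ fibre K.colour j) (≡-sym colours) (∈class y∈P))
      (trans (*-cancelʳ-≡ (rank (class x) x) (rank (class y) y) (suc k)
               (+-cancelʳ-≡ (place (K.colour x)) _ _
                 (trans e (cong (λ j → rank (class y) y * suc k + place j) (≡-sym colours)))))
             (cong (λ j → rank (P ∩ fibre K.colour j) y) (≡-sym colours)))
      where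
      colours : K.colour x ≡ K.colour y
      colours = place-injective (trans (≡-sym (position-%k x)) (trans (cong (_% suc k) e) (position-%k y)))

    slot : ∀ {x} → x ∈ P → Fin m
    slot x∈P = fromℕ< (position<m x∈P)

    toℕ-slot : ∀ {x} (x∈P : x ∈ P) → toℕ (slot x∈P) ≡ position x
    toℕ-slot x∈P = Finₚ.toℕ-fromℕ< (position<m x∈P)

    toℕ-residue-slot : ∀ {x} (x∈P : x ∈ P) → toℕ (residue k (slot x∈P)) ≡ place (K.colour x)
    toℕ-residue-slot {x} x∈P = trans (toℕ-residue k (slot x∈P)) (trans (cong (_% suc k) (toℕ-slot x∈P)) (position-%k x))

    T = turan (suc k) m

    slot-adj : ∀ {x y} (x∈P : x ∈ P) (y∈P : y ∈ P) → adj G x y ≡ adj T (slot x∈P) (slot y∈P)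
    slot-adj {x} {y} x∈P y∈P with K.colour x Finₚ.≟ K.colour y
    ... | yes e = adj-≡ G x y T (slot x∈P) (slot y∈P) (λ y∈N → contradiction y∈N (K.same x∈P y∈P e))
      (λ y∈N → contradiction y∈N (turan-same k (slot x∈P) (slot y∈P) (Finₚ.toℕ-injective
        (trans (toℕ-residue-slot x∈P) (trans (cong place e) (≡-sym (toℕ-residue-slot y∈P)))))))
    ... | no x≢y = adj-≡ G x y T (slot x∈P) (slot y∈P) (λ _ → turan-differ k (slot x∈P) (slot y∈P) λ e → x≢y (place-injective
        (trans (≡-sym (toℕ-residue-slot x∈P)) (trans (cong toℕ e) (toℕ-residue-slot y∈P)))))
      (λ _ → K.differ x∈P y∈P x≢y)

    ∉P⇒≡v : ∀ {x} → x ∉ P → x ≡ v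
    ∉P⇒≡v {x} x∉P with x Finₚ.≟ v
    ... | yes e = e
    ... | no x≢v = contradiction (∈-remove ∈⊤ x≢v) x∉P

    h : (x : Fin (suc m)) → Dec (x ∈ P) → Fin (suc m)
    h x (yes x∈P) = suc (slot x∈P)
    h x (no _)    = zero

    h-injective : ∀ {x y} (d : Dec (x ∈ P)) (e : Dec (y ∈ P)) → h x d ≡ h y e → x ≡ y
    h-injective (yes x∈P) (yes y∈P) eq = position-injective x∈P y∈P
      (trans (≡-sym (toℕ-slot x∈P)) (trans (cong toℕ (Finₚ.suc-injective eq)) (toℕ-slot y∈P)))
    h-injective (no x∉P)  (no y∉P)  _  = trans (∉P⇒≡v x∉P) (≡-sym (∉P⇒≡v y∉P))

    h-adj : ∀ {x y} (d : Dec (x ∈ P)) (e : Dec (y ∈ P)) → adj G x y ≡ adj (join1 T) (h x d) (h y e)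
    h-adj (yes x∈P) (yes y∈P) = slot-adj x∈P y∈P
    h-adj (yes x∈P) (no y∉P) rewrite ∉P⇒≡v y∉P = holds (adj-sym G (universal x∈P))
    h-adj (no x∉P)  (yes y∈P) rewrite ∉P⇒≡v x∉P = holds (universal y∈P)
    h-adj (no x∉P)  (no y∉P) rewrite ∉P⇒≡v x∉P | ∉P⇒≡v y∉P = irrefl G v

    f : Fin (suc m) → Fin (suc m)
    f x = h x (x ∈? P)

    f-injective : ∀ {x y} → f x ≡ f y → x ≡ y
    f-injective {x} {y} = h-injective (x ∈? P) (y ∈? P)

    f-surjective : ∀ y → ∃[ x ] f x ≡ y
    f-surjective = injective⇒surjective f f-injective

  cone≅join1-turan : G ≅ᴳ join1 (turan (suc k) m)
  cone≅join1-turan = f , proj₁ ∘ f-surjective ,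
    (λ x → f-injective (proj₂ (f-surjective (f x)))) ,
    (λ y → proj₂ (f-surjective y)) ,
    λ x y → h-adj (x ∈? P) (y ∈? P)

-- Enumeration of subsets and the recursive clique count

tally : (X → Bool) → List X → ℕ
tally p xs = length (filterᵇ p xs)

tally-++ : (p : X → Bool) (xs ys : List X) → tally p (xs ++ ys) ≡ tally p xs + tally p ys
tally-++ p []       ys = refl
tally-++ p (x ∷ xs) ys with p x
... | true  = cong suc (tally-++ p xs ys)
... | false = tally-++ p xs ys

tally-map : (p : Y → Bool) (f : X → Y) (xs : List X) → tally p (map f xs) ≡ tally (p ∘ f) xs
tally-map p f []       = refl
tally-map p f (x ∷ xs) with p (f x)
... | true  = cong suc (tally-map p f xs)
... | false = tally-map p f xs

tally-cong : {p q : X → Bool} → (∀ x → p x ≡ q x) → (xs : List X) → tally p xs ≡ tally q xs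
tally-cong p≡q [] = refl
tally-cong {p = p} {q} p≡q (x ∷ xs) with p x | q x | p≡q x
... | true  | _ | refl = cong suc (tally-cong p≡q xs)
... | false | _ | refl = tally-cong p≡q xs

tally-none : {p : X → Bool} → (∀ x → p x ≡ false) → (xs : List X) → tally p xs ≡ 0
tally-none p≡f [] = refl
tally-none p≡f (x ∷ xs) rewrite p≡f x = tally-none p≡f xs

-- A clique test arranged along the recursion of `cliques`, so that tallying it splits on the first
-- vertex in the same way. `isClique`, which tests all pairs at once, is matched with it through
-- `IsCliqueIn`.
within : Graph n → Subset n → Vec Bool n → Bool
within G P []          = true
within G P (true  ∷ S) = P zero ∧ within (tailᴳ G) (tail P ∩ tail (adj G zero)) S
within G P (false ∷ S) = within (tailᴳ G) (tail P) S

tally-within : (G : Graph n) (k : ℕ) (P : Subset n) →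
  tally (λ S → (size S ≡ᵇ k) ∧ within G P S) (allSubsets n) ≡ cliques G k P
tally-within {zero}  G zero    P = refl
tally-within {zero}  G (suc k) P = refl
tally-within {suc n} G k       P = trans (tally-++ p (map (true ∷_) (allSubsets n)) _)
  (trans (cong₂ _+_ (tally-map p (true ∷_) (allSubsets n)) (tally-map p (false ∷_) (allSubsets n))) (split k))
  where
  p : Vec Bool (suc n) → Bool
  p S = (size S ≡ᵇ k) ∧ within G P S
  split : ∀ k → tally (λ S → (suc (size S) ≡ᵇ k) ∧ within G P (true ∷ S)) (allSubsets n) +
    tally (λ S → (size S ≡ᵇ k) ∧ within G P (false ∷ S)) (allSubsets n) ≡ cliques G k P
  split zero = cong₂ _+_ (tally-none (λ _ → refl) (allSubsets n)) (tally-within (tailᴳ G) zero (tail P))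
  split (suc k) = cong₂ _+_ first (tally-within (tailᴳ G) (suc k) (tail P))
    where
    first : tally (λ S → (size S ≡ᵇ k) ∧ within G P (true ∷ S)) (allSubsets n) ≡
      (if P zero then cliques (tailᴳ G) k (tail P ∩ tail (adj G zero)) else 0)
    first with P zero
    ... | true  = tally-within (tailᴳ G) k (tail P ∩ tail (adj G zero))
    ... | false = tally-none (λ S → ∧-zeroʳ (size S ≡ᵇ k)) (allSubsets n)

IsCliqueIn : Graph n → Subset n → Vec Bool n → Set
IsCliqueIn G P S = lookup S ⊆ P × (∀ {i j} → i ∈ lookup S → j ∈ lookup S → i ≢ j → j ∈ adj G i)

within⇒ : (G : Graph n) (P : Subset n) (S : Vec Bool n) → within G P S ≡ true → IsCliqueIn G P S
within⇒ G P [] _ = (λ { {()} }) , λ { {()} }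
within⇒ G P (false ∷ S) e with S⊆P , clique ← within⇒ (tailᴳ G) (tail P) S e =
  (λ { {suc i} (mem i∈) → tail⁻ (S⊆P (mem i∈)) ; {zero} (mem ()) }) ,
  λ { {zero} (mem ()) ; {suc i} {zero} _ (mem ())
    ; {suc i} {suc j} (mem i∈) (mem j∈) i≢j → mem (holds (clique (mem i∈) (mem j∈) (i≢j ∘ cong suc))) }
within⇒ G P (true ∷ S) e
  with S⊆P , clique ← within⇒ (tailᴳ G) (tail P ∩ tail (adj G zero)) S (∧-conicalʳ (P zero) _ e) =
  (λ { {zero} _ → mem (∧-conicalˡ (P zero) _ e) ; {suc i} (mem i∈) → tail⁻ (∩-⊆ˡ (S⊆P (mem i∈))) }) ,
  λ { {zero} {zero} _ _ i≢j → contradiction refl i≢j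
    ; {zero} {suc j} _ (mem j∈) _ → tail⁻ (∩-⊆ʳ (S⊆P (mem j∈)))
    ; {suc i} {zero} (mem i∈) _ _ → adj-sym G (tail⁻ (∩-⊆ʳ (S⊆P (mem i∈))))
    ; {suc i} {suc j} (mem i∈) (mem j∈) i≢j → mem (holds (clique (mem i∈) (mem j∈) (i≢j ∘ cong suc))) }

⇒within : (G : Graph n) (P : Subset n) (S : Vec Bool n) → IsCliqueIn G P S → within G P S ≡ true
⇒within G P [] _ = refl
⇒within G P (false ∷ S) (S⊆P , clique) = ⇒within (tailᴳ G) (tail P) S
  ((λ { (mem i∈) → tail⁺ (S⊆P (mem i∈)) }) ,
   λ { (mem i∈) (mem j∈) i≢j → mem (holds (clique {suc _} {suc _} (mem i∈) (mem j∈) (i≢j ∘ Finₚ.suc-injective))) })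
⇒within G P (true ∷ S) (S⊆P , clique) = cong₂ _∧_ (holds (S⊆P (mem refl)))
  (⇒within (tailᴳ G) (tail P ∩ tail (adj G zero)) S
    ((λ { (mem i∈) → ∈-∩ (tail⁺ (S⊆P (mem i∈))) (tail⁺ (clique {zero} {suc _} (mem refl) (mem i∈) λ ())) }) ,
     λ { (mem i∈) (mem j∈) i≢j → mem (holds (clique {suc _} {suc _} (mem i∈) (mem j∈) (i≢j ∘ Finₚ.suc-injective))) }))

allᵇ-tabulate⇒ : (p : X → Bool) (f : Fin n → X) → allᵇ p (tabulate f) ≡ true → ∀ i → p (f i) ≡ true
allᵇ-tabulate⇒ p f e zero    = ∧-conicalˡ (p (f zero)) _ e
allᵇ-tabulate⇒ p f e (suc i) = allᵇ-tabulate⇒ p (f ∘ suc) (∧-conicalʳ (p (f zero)) _ e) i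

⇒allᵇ-tabulate : (p : X → Bool) (f : Fin n → X) → (∀ i → p (f i) ≡ true) → allᵇ p (tabulate f) ≡ true
⇒allᵇ-tabulate {n = zero}  p f all = refl
⇒allᵇ-tabulate {n = suc n} p f all = cong₂ _∧_ (all zero) (⇒allᵇ-tabulate p (f ∘ suc) (all ∘ suc))

isClique⇒ : (G : Graph n) (S : Vec Bool n) → isClique G S ≡ true → IsCliqueIn G ⊤ S
isClique⇒ G S e = (λ _ → ∈⊤) , λ {i} {j} i∈ j∈ i≢j →
  mem (implication (holds i∈) (holds j∈) (¬-not (i≢j ∘ eqFin⇒≡ i j))
    (allᵇ-tabulate⇒ _ (λ x → x) (allᵇ-tabulate⇒ _ (λ x → x) e i) j))
  where
  implication : ∀ {s t e a} → s ≡ true → t ≡ true → e ≡ false → not (s ∧ t ∧ not e) ∨ a ≡ true → a ≡ true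
  implication refl refl refl a = a

⇒isClique : (G : Graph n) (S : Vec Bool n) → IsCliqueIn G ⊤ S → isClique G S ≡ true
⇒isClique G S (_ , clique) = ⇒allᵇ-tabulate _ (λ x → x) λ i → ⇒allᵇ-tabulate _ (λ x → x) λ j →
  implication (lookup S i) (lookup S j) (eqFin i j) λ i∈ j∈ i≢j → holds (clique (mem i∈) (mem j∈) λ { refl → not-¬ i≢j (eqFin-refl i) })
  where
  implication : ∀ s t e {a} → (s ≡ true → t ≡ true → e ≡ false → a ≡ true) → not (s ∧ t ∧ not e) ∨ a ≡ true
  implication true  true  false f = f refl refl refl
  implication true  true  true  f = refl
  implication true  false e     f = refl
  implication false t     e     f = refl

copiesK≡cliques : (k : ℕ) (G : Graph n) → copiesK k G ≡ cliques G k ⊤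
copiesK≡cliques {n} k G = trans
  (tally-cong (λ S → cong ((size S ≡ᵇ k) ∧_)
    (⇔→≡ (mk⇔ (⇒within G ⊤ S ∘ isClique⇒ G S) (⇒isClique G S ∘ within⇒ G ⊤ S)))) (allSubsets n))
  (tally-within G k ⊤)

-- Two disjoint cliques

side-↑ˡ : (a : Fin r) → side r (a ↑ˡ r) ≡ true
side-↑ˡ {r} a = dec-true (toℕ (a ↑ˡ r) <? r) (subst (_< r) (≡-sym (Finₚ.toℕ-↑ˡ a r)) (Finₚ.toℕ<n a))

side-↑ʳ : (a : Fin r) → side r (r ↑ʳ a) ≡ false
side-↑ʳ {r} a = dec-false (toℕ (r ↑ʳ a) <? r) (≤⇒≯ (subst (r ≤_) (≡-sym (Finₚ.toℕ-↑ʳ r a)) (m≤m+n r (toℕ a))))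

record DisjointCliques (r : ℕ) (G : Graph n) : Set where
  field
    first    : CliqueIn G r ⊤
    second   : CliqueIn G r ⊤
    disjoint : ∀ {i j} → CliqueIn.vertex first i ≢ CliqueIn.vertex second j

DisjointCliques⇒B⊆ : {G : Graph n} → DisjointCliques r G → B r ⊆ᴳ G
DisjointCliques⇒B⊆ {n} {r} {G} D = g ∘ splitAt r ,
  (λ {i} {j} e → trans (≡-sym (Finₚ.join-splitAt r r i))
     (trans (cong (join r r) (g-injective (splitAt r i) (splitAt r j) e)) (Finₚ.join-splitAt r r j))) ,
  (λ i j e → g-adj (splitAt r i) (splitAt r j) (subst₂ (λ i j → adj (B r) i j ≡ true)
     (≡-sym (Finₚ.join-splitAt r r i)) (≡-sym (Finₚ.join-splitAt r r j)) e))
  where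
  open DisjointCliques D
  module C₁ = CliqueIn first
  module C₂ = CliqueIn second
  g : Fin r ⊎ Fin r → Fin n
  g = [ C₁.vertex , C₂.vertex ]′
  g-injective : ∀ x y → g x ≡ g y → x ≡ y
  g-injective (inj₁ a) (inj₁ b) e = cong inj₁ (C₁.vertex-injective e)
  g-injective (inj₂ a) (inj₂ b) e = cong inj₂ (C₂.vertex-injective e)
  g-injective (inj₁ a) (inj₂ b) e = contradiction e disjoint
  g-injective (inj₂ a) (inj₁ b) e = contradiction (≡-sym e) disjoint
  distinct : {i j : Fin (r + r)} → adj (B r) i j ≡ true → i ≢ j
  distinct {i} e refl = not-¬ (irrefl (B r) i) e
  g-adj : ∀ x y → adj (B r) (join r r x) (join r r y) ≡ true → adj G (g x) (g y) ≡ true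
  g-adj (inj₁ a) (inj₁ b) e = holds (C₁.adjacent λ a≡b → distinct {a ↑ˡ r} e (cong (_↑ˡ r) a≡b))
  g-adj (inj₂ a) (inj₂ b) e = holds (C₂.adjacent λ a≡b → distinct {r ↑ʳ a} e (cong (r ↑ʳ_) a≡b))
  g-adj (inj₁ a) (inj₂ b) e rewrite side-↑ˡ a | side-↑ʳ b = contradiction e λ ()
  g-adj (inj₂ a) (inj₁ b) e rewrite side-↑ˡ b | side-↑ʳ a = contradiction e λ ()

B⊆⇒DisjointCliques : {G : Graph n} → B r ⊆ᴳ G → DisjointCliques r G
B⊆⇒DisjointCliques {n} {r} {G} (f , f-injective , f-adj) = record
  { first    = record
    { vertex   = λ i → f (i ↑ˡ r)
    ; within   = λ _ → ∈⊤
    ; adjacent = λ {i} {j} i≢j → mem (f-adj _ _ (cong₂ _∧_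
        (trans (cong₂ eqB (side-↑ˡ i) (side-↑ˡ j)) refl)
        (cong not (¬-not (i≢j ∘ Finₚ.↑ˡ-injective r i j ∘ eqFin⇒≡ (i ↑ˡ r) (j ↑ˡ r))))))
    }
  ; second   = record
    { vertex   = λ i → f (r ↑ʳ i)
    ; within   = λ _ → ∈⊤
    ; adjacent = λ {i} {j} i≢j → mem (f-adj _ _ (cong₂ _∧_
        (trans (cong₂ eqB (side-↑ʳ i) (side-↑ʳ j)) refl)
        (cong not (¬-not (i≢j ∘ Finₚ.↑ʳ-injective r i j ∘ eqFin⇒≡ (r ↑ʳ i) (r ↑ʳ j))))))
    }
  ; disjoint = λ {i} {j} e → contradiction
      (trans (≡-sym (side-↑ˡ i)) (trans (cong (side r) (f-injective e)) (side-↑ʳ j))) λ ()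
  }

unjoin : {x : Fin (suc n)} → x ≢ zero → Fin n
unjoin {x = zero}  x≢0 = contradiction refl x≢0
unjoin {x = suc y} x≢0 = y

CliqueIn-unjoin : {G : Graph n} (K : CliqueIn (join1 G) r ⊤) → (∀ i → CliqueIn.vertex K i ≢ zero) → CliqueIn G r ⊤
CliqueIn-unjoin {G = G} K avoids = record
  { vertex   = λ i → unjoin (avoids i)
  ; within   = λ _ → ∈⊤
  ; adjacent = λ {i} {j} i≢j → unjoin-adj (avoids i) (avoids j) (CliqueIn.adjacent K i≢j)
  }
  where
  unjoin-adj : ∀ {x y} (x≢0 : x ≢ zero) (y≢0 : y ≢ zero) → y ∈ adj (join1 G) x → unjoin y≢0 ∈ adj G (unjoin x≢0)
  unjoin-adj {zero}           x≢0 y≢0 _       = contradiction refl x≢0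
  unjoin-adj {suc x} {zero}   x≢0 y≢0 _       = contradiction refl y≢0
  unjoin-adj {suc x} {suc y}  x≢0 y≢0 (mem e) = mem e

-- Of two disjoint cliques at least one avoids the apex, and would be a clique on `2 + k` vertices
-- in a graph with `suc k` parts.
join1-turan-free : (k m : ℕ) → Free (B (2 + k)) (join1 (turan (suc k) m))
join1-turan-free k m B⊆ with D ← B⊆⇒DisjointCliques B⊆
  with Finₚ.any? (λ i → CliqueIn.vertex (DisjointCliques.first D) i Finₚ.≟ zero)
     | Finₚ.any? (λ i → CliqueIn.vertex (DisjointCliques.second D) i Finₚ.≟ zero)
... | yes (_ , e) | yes (_ , e′) = DisjointCliques.disjoint D (trans e (≡-sym e′))
... | no avoids   | _            = turan-CliqueIn-absurd k m (CliqueIn-unjoin (DisjointCliques.first D) λ i e → avoids (i , e))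
... | _           | no avoids    = turan-CliqueIn-absurd k m (CliqueIn-unjoin (DisjointCliques.second D) λ i e → avoids (i , e))

cliques-join1-turan : (k m : ℕ) → cliques (join1 (turan (suc k) m)) (2 + k) ⊤ ≡ cliques (turan (suc k) m) (suc k) ⊤
cliques-join1-turan k m = begin-equality
  cliques (join1 T) (2 + k) ⊤
    ≡⟨ cliques-zero∈ (join1 T) (suc k) ⊤ ∈⊤ ⟩
  cliques T (suc k) (tail ⊤ ∩ tail (adj (join1 T) zero)) + cliques T (2 + k) (tail ⊤)
    ≡⟨ cong₂ _+_ (cliques-cong T (suc k) (λ _ → ∈⊤) (λ _ → ∈-∩ (tail⁺ ∈⊤) (tail⁺ (mem refl)))) (turan-K-free k m (tail ⊤)) ⟩
  cliques T (suc k) ⊤ + 0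
    ≡⟨ +-identityʳ _ ⟩
  cliques T (suc k) ⊤ ∎
  where
  T = turan (suc k) m

-- Cliques without a common vertex

infixl 6 _∖_

_∖_ : Subset n → (Fin l → Fin n) → Subset n
_∖_ {l = zero}  P f = P
_∖_ {l = suc l} P f = (P - f zero) ∖ (f ∘ suc)

∈-∖ : {P : Subset n} (f : Fin l → Fin n) {x : Fin n} → x ∈ P → (∀ i → x ≢ f i) → x ∈ P ∖ f
∈-∖ {l = zero}  f x∈P x≢f = x∈P
∈-∖ {l = suc l} f x∈P x≢f = ∈-∖ (f ∘ suc) (∈-remove x∈P (x≢f zero)) (x≢f ∘ suc)

∖-⊆ : {P : Subset n} (f : Fin l → Fin n) → P ∖ f ⊆ P
∖-⊆ {l = zero}  f x∈ = x∈
∖-⊆ {l = suc l} f x∈ = remove-⊆ (∖-⊆ (f ∘ suc) x∈)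

∖-≢ : {P : Subset n} (f : Fin l → Fin n) {x : Fin n} → x ∈ P ∖ f → ∀ i → x ≢ f i
∖-≢ {l = suc l} f x∈ zero    = remove-≢ (∖-⊆ (f ∘ suc) x∈)
∖-≢ {l = suc l} f x∈ (suc i) = ∖-≢ (f ∘ suc) x∈ i

-- A counterpart of `cliques-⊆∩` for deleting listed vertices. The list may leave `P` or repeat
-- itself, and the multiplier is its fixed length `l`.
cliques-∖ : (G : Graph n) (k : ℕ) (P : Subset n) (f : Fin l → Fin n) (D : ℕ) →
  (∀ i → cliques G k (P ∩ adj G (f i)) ≤ D) → cliques G (suc k) P ≤ cliques G (suc k) (P ∖ f) + l * D
cliques-∖ {l = zero}  G k P f D bound = m≤m+n _ 0
cliques-∖ {l = suc l} G k P f D bound = begin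
  cliques G (suc k) P
    ≤⟨ first (f zero ∈? P) ⟩
  D + cliques G (suc k) (P - f zero)
    ≤⟨ +-monoʳ-≤ D (cliques-∖ G k (P - f zero) (f ∘ suc) D λ i →
         ≤-trans (cliques-mono G k (∩-monoˡ remove-⊆)) (bound (suc i))) ⟩
  D + (cliques G (suc k) (P ∖ f) + l * D)
    ≡⟨ +-assoc D _ _ ⟨
  D + cliques G (suc k) (P ∖ f) + l * D
    ≡⟨ trans (cong (_+ l * D) (+-comm D _)) (+-assoc _ D (l * D)) ⟩
  cliques G (suc k) (P ∖ f) + suc l * D ∎
  where
  first : Dec (f zero ∈ P) → cliques G (suc k) P ≤ D + cliques G (suc k) (P - f zero)
  first (yes f∈P) = ≤-trans (≤-reflexive (trans (cliques-remove G k P f∈P) (+-comm _ (cliques G k (P ∩ adj G (f zero))))))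
    (+-monoˡ-≤ _ (bound zero))
  first (no  f∉P) = ≤-trans (cliques-mono G (suc k) λ x∈P → ∈-remove x∈P λ { refl → f∉P x∈P }) (m≤n+m _ D)

module _ (G : Graph n) (k : ℕ) (free : Free (B (2 + k)) G) where
  private
    r′ = 2 + k

  cliques-avoiding-clique : {Q : Subset n} (K : CliqueIn G r′ Q) → cliques G r′ (⊤ ∖ CliqueIn.vertex K) ≡ 0
  cliques-avoiding-clique K = n≤0⇒n≡0 (≮⇒≥ λ 0<c →
    let K′ = cliques>0⇒CliqueIn G r′ (⊤ ∖ CliqueIn.vertex K) 0<c in
    free (DisjointCliques⇒B⊆ record
      { first    = widen K
      ; second   = widen K′
      ; disjoint = λ {i} {j} e → ∖-≢ (CliqueIn.vertex K) (CliqueIn.within K′ j) i (≡-sym e)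
      }))
    where
    widen : {Q : Subset n} → CliqueIn G r′ Q → CliqueIn G r′ ⊤
    widen C = record { vertex = CliqueIn.vertex C ; within = λ _ → ∈⊤ ; adjacent = CliqueIn.adjacent C }

  -- Every clique meets a fixed clique C in some u, and also meets a clique avoiding u.
  cliques-without-apex : Fin n → (∀ v → 0 < cliques G r′ (⊤ - v)) → cliques G r′ ⊤ ≤ r′ * (r′ * n ^ k)
  cliques-without-apex v₀ spread = begin
    cliques G r′ ⊤
      ≤⟨ cliques-∖ G (suc k) ⊤ (CliqueIn.vertex (clique v₀)) (r′ * n ^ k) (through ∘ CliqueIn.vertex (clique v₀)) ⟩
    cliques G r′ (⊤ ∖ CliqueIn.vertex (clique v₀)) + r′ * (r′ * n ^ k)
      ≡⟨ cong (_+ r′ * (r′ * n ^ k)) (cliques-avoiding-clique (clique v₀)) ⟩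
    r′ * (r′ * n ^ k) ∎
    where
    clique : ∀ v → CliqueIn G r′ (⊤ - v)
    clique v = cliques>0⇒CliqueIn G r′ (⊤ - v) (spread v)
    through : ∀ u → cliques G (suc k) (⊤ ∩ adj G u) ≤ r′ * n ^ k
    through u = begin
      cliques G (suc k) (⊤ ∩ adj G u)
        ≤⟨ cliques-∖ G k (⊤ ∩ adj G u) w (n ^ k) (λ i → cliques≤^ G k _) ⟩
      cliques G (suc k) ((⊤ ∩ adj G u) ∖ w) + r′ * n ^ k
        ≤⟨ +-monoˡ-≤ (r′ * n ^ k) (cliques-mono G (suc k) λ x∈ →
             ∈-∩ (∈-∖ {P = ⊤} w ∈⊤ (∖-≢ w x∈)) (∩-⊆ʳ (∖-⊆ w x∈))) ⟩
      -- The clique `w` was chosen to avoid `u`, so `u` survives the deletion of `w`; adding it to a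
      -- clique counted here gives one on `r′` vertices disjoint from `w`.
      cliques G (suc k) ((⊤ ∖ w) ∩ adj G u) + r′ * n ^ k
        ≤⟨ +-monoˡ-≤ (r′ * n ^ k) (cliques-extend G (suc k) (⊤ ∖ w)
             (∈-∖ w ∈⊤ λ i u≡w → remove-≢ (CliqueIn.within (clique u) i) (≡-sym u≡w))) ⟩
      cliques G r′ (⊤ ∖ w) + r′ * n ^ k
        ≡⟨ cong (_+ r′ * n ^ k) (cliques-avoiding-clique (clique u)) ⟩
      r′ * n ^ k ∎
      where
      w = CliqueIn.vertex (clique u)

-- How large `n` has to be

^-distribʳ-* : ∀ x y k → (x * y) ^ k ≡ x ^ k * y ^ k
^-distribʳ-* x y zero    = refl
^-distribʳ-* x y (suc k) = trans (cong (x * y *_) (^-distribʳ-* x y k)) (shuffle x y (x ^ k) (y ^ k))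
  where
  shuffle : ∀ x y z w → x * y * (z * w) ≡ x * z * (y * w)
  shuffle = solve-∀

-- Since n ≤ 2(k+1)q, the bound r² n^k is at most this multiple of q^k.
threshold : ℕ → ℕ
threshold k = (2 + k) * (2 + k) * (2 * suc k) ^ k

threshold< : (k m : ℕ) → suc (threshold k) ≤ m / suc k → (2 + k) * ((2 + k) * suc m ^ k) < (m / suc k) ^ suc k
threshold< k m large = begin-strict
  (2 + k) * ((2 + k) * suc m ^ k)
    ≡⟨ *-assoc (2 + k) (2 + k) (suc m ^ k) ⟨
  (2 + k) * (2 + k) * suc m ^ k
    ≤⟨ *-monoʳ-≤ ((2 + k) * (2 + k)) (^-monoˡ-≤ k 1+m≤) ⟩
  (2 + k) * (2 + k) * (2 * suc k * q) ^ k
    ≡⟨ cong ((2 + k) * (2 + k) *_) (^-distribʳ-* (2 * suc k) q k) ⟩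
  (2 + k) * (2 + k) * ((2 * suc k) ^ k * q ^ k)
    ≡⟨ *-assoc ((2 + k) * (2 + k)) ((2 * suc k) ^ k) _ ⟨
  threshold k * q ^ k
    <⟨ *-monoˡ-< (q ^ k) {{m^n≢0 q k}} large ⟩
  q * q ^ k ∎
  where
  q = m / suc k
  instance
    q-nonZero : NonZero q
    q-nonZero = >-nonZero (≤-trans z<s large)
  shuffle : ∀ q k → q * suc k + q * suc k ≡ 2 * suc k * q
  shuffle = solve-∀
  1+m≤ : suc m ≤ 2 * suc k * q
  -- The remainder is below `suc k`, hence at most one more row of the `q` rows; `q` being positive,
  -- doubling absorbs it.
  1+m≤ = begin
    suc m                          ≡⟨ cong suc (m≡m%n+[m/n]*n m (suc k)) ⟩
    suc (m % suc k) + q * suc k    ≤⟨ +-monoˡ-≤ (q * suc k) (m%n<n m (suc k)) ⟩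
    suc k + q * suc k              ≤⟨ +-monoˡ-≤ (q * suc k) (m≤n*m (suc k) q) ⟩
    q * suc k + q * suc k          ≡⟨ shuffle q k ⟩
    2 * suc k * q ∎

-- Extremal graphs for large `n`

module _ (k m : ℕ) (large : suc (threshold k) ≤ m / suc k) where
  private
    q = m / suc k
    b : Fin (suc k) → ℕ
    b = turan-sizes q (m % suc k)
    T = turan (suc k) m

    instance
      q-nonZero : NonZero q
      q-nonZero = >-nonZero (≤-trans z<s large)

    b-near : ∀ j → b j ≡ q ⊎ b j ≡ suc q
    b-near j with j ∈? below (m % suc k)
    ... | yes j∈ = inj₂ (turan-sizes-∈ q (m % suc k) j∈)
    ... | no  j∉ = inj₁ (turan-sizes-∉ q (m % suc k) j∉)

    q≤b : ∀ j → q ≤ b j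
    q≤b j with b-near j
    ... | inj₁ e = ≤-reflexive (≡-sym e)
    ... | inj₂ e = ≤-trans (n≤1+n q) (≤-reflexive (≡-sym e))

  Extremal : Graph (suc m) → Set
  Extremal G = cliques G (2 + k) ⊤ ≤ cliques T (suc k) ⊤ ×
    (cliques T (suc k) ⊤ ≤ cliques G (2 + k) ⊤ → G ≅ᴳ join1 T)

  without-apex : (G : Graph (suc m)) → Free (B (2 + k)) G → (∀ v → 0 < cliques G (2 + k) (⊤ - v)) → Extremal G
  without-apex G free spread = <⇒≤ few , λ many → contradiction many (<⇒≱ few)
    where
    few : cliques G (2 + k) ⊤ < cliques T (suc k) ⊤
    few = begin-strict
      cliques G (2 + k) ⊤              ≤⟨ cliques-without-apex G k free zero spread ⟩
      (2 + k) * ((2 + k) * suc m ^ k)  <⟨ threshold< k m large ⟩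
      q ^ suc k                        ≡⟨ prodF-const (suc k) q ⟨
      prodF {suc k} (λ _ → q)          ≤⟨ prodF-mono q≤b ⟩
      prodF b                          ≤⟨ prodF-turan-sizes≤cliques k m ⟩
      cliques T (suc k) ⊤ ∎

  -- The counts form one chain: cliques of `G`, smaller cliques in the neighbourhood of `v`, those
  -- in `G` without `v`, `prodF a`, `prodF b`, and the Turán count. Extremality closes it, and its
  -- links give in turn that `v` sees everything, that the rest is complete partite, and that the
  -- sizes are balanced.
  with-apex : (G : Graph (suc m)) (v : Fin (suc m)) → cliques G (2 + k) (⊤ - v) ≡ 0 → Extremal G
  with-apex G v K-free with a , sum-a , P≤prod , partite ← zykov G k (⊤ - v) K-free =
    ≤-trans (≤-trans G≤P P≤prod) (≤-trans a≤b (prodF-turan-sizes≤cliques k m)) , λ extremal →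
    let b≤G   = ≤-trans (prodF-turan-sizes≤cliques k m) extremal
        a≤G   = ≤-trans a≤b b≤G
        b≤a   = ≤-trans b≤G (≤-trans G≤P P≤prod)
        -- The equality clause also asks for a positive product; it holds because each entry of `b`
        -- is at least `q`, which is positive.
        parts = partite (≤-trans a≤G G≤P) (≤-trans (prodF-positive λ j → ≤-trans (>-nonZero⁻¹ q) (q≤b j)) b≤a)
    in cone≅join1-turan k m q G v parts
         (universal parts (≤-trans P≤prod (≤-trans a≤G (≤-reflexive G≡N))))
         (Balanced.extremal⇒Near q a b same-sum b-near b≤a) sum-a′
    where
    G≡N : cliques G (2 + k) ⊤ ≡ cliques G (suc k) (⊤ ∩ adj G v)
    G≡N = trans (cliques-remove G (suc k) ⊤ {v} ∈⊤) (cong (_+ cliques G (suc k) (⊤ ∩ adj G v)) K-free)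
    N⊆P : ⊤ ∩ adj G v ⊆ ⊤ - v
    N⊆P x∈ = ∈-remove ∈⊤ λ { refl → adj-irrefl G (∩-⊆ʳ x∈) }
    G≤P : cliques G (2 + k) ⊤ ≤ cliques G (suc k) (⊤ - v)
    G≤P = ≤-trans (≤-reflexive G≡N) (cliques-mono G (suc k) N⊆P)
    sum-a′ : sumF a ≡ m
    sum-a′ = trans sum-a (suc-injective (trans (≡-sym (count-remove ⊤ {v} ∈⊤)) (count-⊤ (suc m))))
    same-sum : sumF a ≡ sumF b
    same-sum = trans sum-a′ (≡-sym (sumF-turan-sizes k m))
    a≤b : prodF a ≤ prodF b
    a≤b = Balanced.prodF≤balanced q a b same-sum b-near
    -- A vertex `x` not adjacent to `v` would lie in a clique of `⊤ - v` that is not inside the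
    -- neighbourhood of `v`, against the equality of the two counts.
    universal : CompletePartite G (⊤ - v) a → cliques G (suc k) (⊤ - v) ≤ cliques G (suc k) (⊤ ∩ adj G v) → ⊤ - v ⊆ adj G v
    universal parts P≤N {x} x∈P with x ∈? adj G v
    ... | yes x∈N = x∈N
    ... | no  x∉N = contradiction P≤N (<⇒≱ (begin-strict
      cliques G (suc k) (⊤ ∩ adj G v)
        ≤⟨ cliques-mono G (suc k) (λ y∈ → ∈-remove (N⊆P y∈) λ { refl → x∉N (∩-⊆ʳ y∈) }) ⟩
      cliques G (suc k) (⊤ - v - x)
        <⟨ m<m+n _ (CompletePartite.extends parts x∈P) ⟩
      cliques G (suc k) (⊤ - v - x) + cliques G k ((⊤ - v) ∩ adj G x)
        ≡⟨ cliques-remove G k (⊤ - v) x∈P ⟨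
      cliques G (suc k) (⊤ - v) ∎))

  extremal : (G : Graph (suc m)) → Free (B (2 + k)) G → Extremal G
  extremal G free with Finₚ.any? (λ v → cliques G (2 + k) (⊤ - v) ≟ 0)
  ... | yes (v , K-free) = with-apex G v K-free
  ... | no  none         = without-apex G free λ v → n≢0⇒n>0 λ e → none (v , e)

theorem1p5 : (r : ℕ) → 3 ≤ r → ∃[ N ] ∀ (n : ℕ) → N ≤ n →
    ((G : Graph n) → Free (B r) G →
    copiesK r G ≤ copiesK (r ∸ 1) (turan (r ∸ 1) (n ∸ 1)))
    × Free (B r) (join1 (turan (r ∸ 1) (n ∸ 1)))
    × copiesK r (join1 (turan (r ∸ 1) (n ∸ 1))) ≡ copiesK (r ∸ 1) (turan (r ∸ 1) (n ∸ 1))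
    × ((G : Graph n) → Free (B r) G →
    copiesK r G ≡ copiesK (r ∸ 1) (turan (r ∸ 1) (n ∸ 1)) →
    G ≅ᴳ join1 (turan (r ∸ 1) (n ∸ 1)))
-- With `r = 2 + k` and `n = suc m`, the bound on `n` is the one that makes the quotient `m / suc k`
-- at least `suc (threshold k)`.
theorem1p5 (suc zero) (s≤s ())
theorem1p5 (suc (suc k)) _ = suc (suc (threshold k) * suc k) , λ { (suc m) (s≤s N≤m) →
  let large = ≤-trans (≤-reflexive (≡-sym (m*n/n≡m (suc (threshold k)) (suc k)))) (/-monoˡ-≤ (suc k) N≤m)
      T     = turan (suc k) m
      copiesT = copiesK≡cliques (suc k) T
  in (λ G free → subst₂ _≤_ (≡-sym (copiesK≡cliques (2 + k) G)) (≡-sym copiesT) (proj₁ (extremal k m large G free))) ,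
     join1-turan-free k m ,
     trans (copiesK≡cliques (2 + k) (join1 T)) (trans (cliques-join1-turan k m) (≡-sym copiesT)) ,
     λ G free e → proj₂ (extremal k m large G free)
       (≤-reflexive (trans (≡-sym copiesT) (trans (≡-sym e) (copiesK≡cliques (2 + k) G)))) }
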